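{- Let $m$ be a positive integer with $m\ge 12$ and let $i,j\in\{1,2\}$. Then $r(T_m^i,T_{m+1}^j)=r(T_m^*,T_{m+1}^j)=2m-5$.
   Context: All graphs are finite and simple. For graphs $G_1,G_2$, the Ramsey number $r(G_1,G_2)$ is the smallest positive integer $N$ such that for every graph $G$ on $N$ vertices, either $G$ contains a subgraph isomorphic to $G_1$ or the complement $\overline G$ contains a subgraph isomorphic to $G_2$. $T_s^1$ is the tree with vertex set $\{v_0,\ldots,v_{s-1}\}$ and edge set $\{v_0v_1,\ldots,v_0v_{s-3},v_{s-4}v_{s-2},v_{s-3}v_{s-1}\}$; $T_s^2$ is the tree with the same vertex set and edge set $\{v_0v_1,\ldots,v_0v_{s-3},v_{s-3}v_{s-2},v_{s-3}v_{s-1}\}$. $T_m^*$ is the tree with vertex set $\{v_0,\ldots,v_{m-1}\}$ and edge set $\{v_0v_1,\ldots,v_0v_{m-3},v_{m-3}v_{m-2},v_{m-2}v_{m-1}\}$. -}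

module Defs where

open import Data.Nat using (ℕ; zero; suc; _+_; _*_; _∸_; _≤_; _<_; _≡ᵇ_; _≤ᵇ_)
open import Data.Bool using (Bool; true; false; _∧_; _∨_; not)
open import Data.Fin using (Fin; toℕ)
open import Data.Fin.Properties using () renaming (_≟_ to _≟F_)
open import Data.Product using (Σ; _×_)
open import Data.Sum using (_⊎_)
open import Function.Definitions using (Injective)
open import Relation.Binary.PropositionalEquality using (_≡_)
open import Relation.Nullary using (¬_)
open import Relation.Nullary.Decidable using (⌊_⌋)

Graph : ℕ → Set
Graph n = Fin n → Fin n → Bool

IsSimple : ∀ {n} → Graph n → Set
IsSimple {n} G = (∀ (u v : Fin n) → G u v ≡ G v u) × (∀ (u : Fin n) → G u u ≡ false)

complement : ∀ {n} → Graph n → Graph n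
complement G u v = not (G u v) ∧ not ⌊ u ≟F v ⌋

Contains : ∀ {n k} → Graph n → Graph k → Set
Contains {n} {k} G H =
  Σ (Fin k → Fin n) λ f → Injective _≡_ _≡_ f × (∀ u v → H u v ≡ true → G (f u) (f v) ≡ true)

RamseyProp : ∀ {k₁ k₂} → Graph k₁ → Graph k₂ → ℕ → Set
RamseyProp G₁ G₂ N = ∀ (G : Graph N) → IsSimple G → Contains G G₁ ⊎ Contains (complement G) G₂

IsRamseyNumber : ∀ {k₁ k₂} → Graph k₁ → Graph k₂ → ℕ → Set
IsRamseyNumber G₁ G₂ N =
  1 ≤ N × RamseyProp G₁ G₂ N × (∀ M → 1 ≤ M → M < N → ¬ RamseyProp G₁ G₂ M)

fromEdges : (s : ℕ) → (ℕ → ℕ → Bool) → Graph s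
fromEdges s E u v = E (toℕ u) (toℕ v) ∨ E (toℕ v) (toℕ u)

inRange : ℕ → ℕ → Bool
inRange b t = (1 ≤ᵇ b) ∧ (b ≤ᵇ t)

T¹ : (s : ℕ) → Graph s
T¹ s = fromEdges s λ a b →
  ((a ≡ᵇ 0) ∧ inRange b (s ∸ 3))
  ∨ ((a ≡ᵇ (s ∸ 4)) ∧ (b ≡ᵇ (s ∸ 2)))
  ∨ ((a ≡ᵇ (s ∸ 3)) ∧ (b ≡ᵇ (s ∸ 1)))

T² : (s : ℕ) → Graph s
T² s = fromEdges s λ a b →
  ((a ≡ᵇ 0) ∧ inRange b (s ∸ 3))
  ∨ ((a ≡ᵇ (s ∸ 3)) ∧ (b ≡ᵇ (s ∸ 2)))
  ∨ ((a ≡ᵇ (s ∸ 3)) ∧ (b ≡ᵇ (s ∸ 1)))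

T* : (m : ℕ) → Graph m
T* m = fromEdges m λ a b →
  ((a ≡ᵇ 0) ∧ inRange b (m ∸ 3))
  ∨ ((a ≡ᵇ (m ∸ 3)) ∧ (b ≡ᵇ (m ∸ 2)))
  ∨ ((a ≡ᵇ (m ∸ 2)) ∧ (b ≡ᵇ (m ∸ 1)))

data Idx : Set where
  one two : Idx

T : Idx → (s : ℕ) → Graph s
T one = T¹
T two = T²

{-# OPTIONS --safe #-}

-- Put k = m − 3, so that there are 2k + 1 vertices; every tree here is a star (with k leaves for
-- the red trees, k + 1 for the blue one) with two further vertices attached.
--
-- Lower bound: K_{k,k} minus a perfect matching is (k − 1)-regular and its complement is
-- k-regular, so neither has a vertex of large enough degree.
--
-- Upper bound: call the edges of G red and the others blue.
--
-- Suppose v has blue degree at least k + 1 and let Z be its red neighbourhood. If |Z| ≤ 2, then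
-- without a blue tree almost all edges inside the blue neighbourhood of v are red, and a red tree
-- is found there. If |Z| ≥ 3, then without a blue tree the blue edges between the two
-- neighbourhoods are so few that some z ∈ Z is red-adjacent to k blue neighbours of v, and a red
-- tree centred at z uses v as a branching leaf.
--
-- Otherwise every red degree is at least k. A vertex v of red degree k + t with t ≥ 1 has
-- k − t non-neighbours, each with at least t + 1 neighbours among those of v, so a red tree centred
-- at v exists by double counting, or by minimum degree if at most 2 non-neighbours remain. If all
-- red degrees equal k, no neighbour of v is adjacent to every non-neighbour of v, and this again
-- gives the trees, except that T² may have to be centred at a non-neighbour of v.

module Submission where

open import Defs
open import Data.Nat using (ℕ; zero; suc; _+_; _*_; _∸_; _≤_; _<_; z≤n; s≤s; s≤s⁻¹; _≤?_; _≡ᵇ_; _≤ᵇ_)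
open import Data.Product using (_×_; _,_; proj₁; proj₂; ∃; ∃₂)
open import Data.Nat.Properties
open import Data.Nat.Tactic.RingSolver using (solve-∀)
open import Data.Bool using (Bool; true; false; _∧_; _∨_; not)
open import Data.Bool.Properties using (T-≡) renaming (_≟_ to _≟ᵇ_)
open import Data.Empty using (⊥; ⊥-elim)
open import Data.Fin using (Fin; zero; suc; toℕ; inject≤; inject₁; fromℕ; remQuot; combine)
open import Data.Fin.Properties
  using (any?; toℕ-injective; toℕ-inject≤; toℕ<n; inject≤-injective; inject₁-injective;
         fromℕ≢inject₁; combine-remQuot; injective⇒≤)
  renaming (_≟_ to _≟F_)
open import Data.List using (List; []; _∷_; length; _++_)
open import Data.List.Properties using (length-++)
open import Data.List.Relation.Unary.All as All using (All; []; _∷_)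
import Data.List.Relation.Unary.All.Properties as All
open import Data.List.Relation.Unary.AllPairs using ([]; _∷_)
import Data.List.Relation.Unary.AllPairs.Properties as AllPairs
open import Data.List.Relation.Unary.Unique.Propositional using (Unique)
open import Data.Sum using (_⊎_; inj₁; inj₂; map₂)
open import Function using (_∘_; Equivalence)
open import Function.Definitions using (Injective)
open import Relation.Nullary using (¬_; yes; no)
open import Relation.Nullary.Decidable using (⌊_⌋; _×-dec_)
open import Relation.Binary.PropositionalEquality
  using (_≡_; _≢_; refl; sym; trans; cong; cong₂; subst; subst₂; ≢-sym)
open import Algebra.Properties.CommutativeMonoid.Sum +-0-commutativeMonoid
  using (sum; ∑-distrib-+; ∑-comm)

-- Cardinalities of decidable subsets of Fin n

private variable
  n : ℕ
  X : Set

-- Boolean predicates, so that a row `G v` of the adjacency relation is itself the neighbourhood of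
-- `v`.
Sub : ℕ → Set
Sub n = Fin n → Bool

infix 4 _∈_ _∉_ _⊆_
infixl 7 _∩_ _─_

_∈_ _∉_ : Fin n → Sub n → Set
v ∈ p = p v ≡ true
v ∉ p = ¬ (v ∈ p)

_⊆_ : Sub n → Sub n → Set
p ⊆ q = ∀ i → i ∈ p → i ∈ q

_∩_ : Sub n → Sub n → Sub n
(p ∩ q) i = p i ∧ q i

∁ : Sub n → Sub n
∁ p i = not (p i)

⁅_⁆ : Fin n → Sub n
⁅ v ⁆ i = ⌊ i ≟F v ⌋

_─_ : Sub n → Fin n → Sub n
p ─ v = p ∩ ∁ ⁅ v ⁆

∧-intro : ∀ {x y} → x ≡ true → y ≡ true → x ∧ y ≡ true
∧-intro refl refl = refl

∧-elimˡ : ∀ {x y} → x ∧ y ≡ true → x ≡ true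
∧-elimˡ {true} _ = refl

∧-elimʳ : ∀ {x y} → x ∧ y ≡ true → y ≡ true
∧-elimʳ {true} e = e

not-true⇒ : ∀ {x} → not x ≡ true → ¬ (x ≡ true)
not-true⇒ {false} _ ()

⇒not-true : ∀ {x} → ¬ (x ≡ true) → not x ≡ true
⇒not-true {true}  h = ⊥-elim (h refl)
⇒not-true {false} _ = refl

∈⁅⁆⇒≡ : (i v : Fin n) → i ∈ ⁅ v ⁆ → i ≡ v
∈⁅⁆⇒≡ i v e with i ≟F v
... | yes i≡v = i≡v

≡⇒∈⁅⁆ : (i v : Fin n) → i ≡ v → i ∈ ⁅ v ⁆
≡⇒∈⁅⁆ i v e with i ≟F v
... | yes _   = refl
... | no i≢v = ⊥-elim (i≢v e)

∈─ : (p : Sub n) {i v : Fin n} → i ∈ p → i ≢ v → i ∈ (p ─ v)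
∈─ p {i} {v} i∈p i≢v = ∧-intro i∈p (⇒not-true (i≢v ∘ ∈⁅⁆⇒≡ i v))

─⊆ : (p : Sub n) (v : Fin n) → (p ─ v) ⊆ p
─⊆ p v i = ∧-elimˡ

∈─⇒≢ : (p : Sub n) {i v : Fin n} → i ∈ (p ─ v) → i ≢ v
∈─⇒≢ p {i} {v} e i≡v = not-true⇒ (∧-elimʳ {p i} e) (≡⇒∈⁅⁆ i v i≡v)

∉─ : (p : Sub n) (v : Fin n) → v ∉ (p ─ v)
∉─ p v v∈ = ∈─⇒≢ p v∈ refl

∈⊎∉ : (v : Fin n) (p : Sub n) → v ∈ p ⊎ v ∉ p
∈⊎∉ v p with p v
... | true  = inj₁ refl
... | false = inj₂ λ ()

indicator : Bool → ℕ
indicator true  = 1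
indicator false = 0

∣_∣ : Sub n → ℕ
∣ p ∣ = sum (indicator ∘ p)

sum-mono : {f g : Fin n → ℕ} → (∀ i → f i ≤ g i) → sum f ≤ sum g
sum-mono {zero}  h = z≤n
sum-mono {suc n} h = +-mono-≤ (h zero) (sum-mono (h ∘ suc))

sum-*-distribˡ : (t : ℕ) (f : Fin n → ℕ) → t * sum f ≡ sum (λ i → t * f i)
sum-*-distribˡ {zero}  t f = *-zeroʳ t
sum-*-distribˡ {suc n} t f =
  trans (*-distribˡ-+ t (f zero) _) (cong (t * f zero +_) (sum-*-distribˡ t (f ∘ suc)))

∣⊤∣ : ∀ n → ∣ (λ (_ : Fin n) → true) ∣ ≡ n
∣⊤∣ zero    = refl
∣⊤∣ (suc n) = cong suc (∣⊤∣ n)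

sum-zero : {f : Fin n → ℕ} → (∀ i → f i ≡ 0) → sum f ≡ 0
sum-zero {zero}  h = refl
sum-zero {suc n} h = cong₂ _+_ (h zero) (sum-zero (h ∘ suc))

∉⇒indicator≡0 : ∀ {b} → ¬ (b ≡ true) → indicator b ≡ 0
∉⇒indicator≡0 {true}  h = ⊥-elim (h refl)
∉⇒indicator≡0 {false} h = refl

∣∣≡0 : (p : Sub n) → (∀ i → i ∉ p) → ∣ p ∣ ≡ 0
∣∣≡0 p none = sum-zero λ i → ∉⇒indicator≡0 (none i)

∣⁅⁆∣ : (v : Fin n) → ∣ ⁅ v ⁆ ∣ ≡ 1
∣⁅⁆∣ {suc n} zero = cong suc (sum-zero {f = λ (_ : Fin n) → 0} λ _ → refl)
∣⁅⁆∣ (suc v) = trans (≤-antisym (sum-mono λ i → ≤-reflexive (eq i))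
                               (sum-mono λ i → ≤-reflexive (sym (eq i)))) (∣⁅⁆∣ v)
  where
  eq : ∀ i → indicator (⁅ suc v ⁆ (suc i)) ≡ indicator (⁅ v ⁆ i)
  eq i with i ≟F v
  ... | yes _ = refl
  ... | no  _ = refl

cover : (r p q : Sub n) → (∀ i → i ∈ r → i ∈ p ⊎ i ∈ q) → ∣ r ∣ ≤ ∣ p ∣ + ∣ q ∣
cover r p q h = ≤-trans (sum-mono pointwise) (≤-reflexive (∑-distrib-+ (indicator ∘ p) (indicator ∘ q)))
  where
  pointwise : ∀ i → indicator (r i) ≤ indicator (p i) + indicator (q i)
  pointwise i with r i | h i
  ... | false | _ = z≤n
  ... | true  | h′ with h′ refl
  ...   | inj₁ i∈p rewrite i∈p = s≤s z≤n
  ...   | inj₂ i∈q rewrite i∈q = m≤n+m 1 _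

pack : (p q r : Sub n) → p ⊆ r → q ⊆ r → (∀ i → i ∈ p → i ∉ q) → ∣ p ∣ + ∣ q ∣ ≤ ∣ r ∣
pack p q r p⊆r q⊆r disj = ≤-trans (≤-reflexive (sym (∑-distrib-+ (indicator ∘ p) (indicator ∘ q)))) (sum-mono pointwise)
  where
  pointwise : ∀ i → indicator (p i) + indicator (q i) ≤ indicator (r i)
  pointwise i with p i | q i | r i | p⊆r i | q⊆r i | disj i
  ... | false | false | _     | _ | _ | _ = z≤n
  ... | true  | false | true  | _ | _ | _ = ≤-refl
  ... | false | true  | true  | _ | _ | _ = ≤-refl
  ... | true  | true  | _     | _ | _ | d = ⊥-elim (d refl refl)
  ... | true  | false | false | a | _ | _ with () ← a refl
  ... | false | true  | false | _ | b | _ with () ← b refl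

∣∣-mono : (p q : Sub n) → p ⊆ q → ∣ p ∣ ≤ ∣ q ∣
∣∣-mono p q p⊆q = ≤-trans (m≤m+n _ _) (pack p (λ _ → false) q p⊆q (λ _ ()) (λ _ _ ()))

cover₁ : (r q : Sub n) (v : Fin n) → (∀ i → i ∈ r → i ≡ v ⊎ i ∈ q) → ∣ r ∣ ≤ suc ∣ q ∣
cover₁ r q v h = subst (λ k → ∣ r ∣ ≤ k + ∣ q ∣) (∣⁅⁆∣ v) (cover r ⁅ v ⁆ q h′)
  where
  h′ : ∀ i → i ∈ r → i ∈ ⁅ v ⁆ ⊎ i ∈ q
  h′ i i∈r with h i i∈r
  ... | inj₁ i≡v = inj₁ (≡⇒∈⁅⁆ i v i≡v)
  ... | inj₂ i∈q = inj₂ i∈q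

pack₁ : (q r : Sub n) (v : Fin n) → v ∈ r → q ⊆ r → v ∉ q → suc ∣ q ∣ ≤ ∣ r ∣
pack₁ q r v v∈r q⊆r v∉q = subst (λ k → k + ∣ q ∣ ≤ ∣ r ∣) (∣⁅⁆∣ v)
  (pack ⁅ v ⁆ q r
    (λ i e → subst (_∈ r) (sym (∈⁅⁆⇒≡ i v e)) v∈r) q⊆r
    (λ i e → subst (_∉ q) (sym (∈⁅⁆⇒≡ i v e)) v∉q))

≡⊎≢ : (u v : Fin n) → u ≡ v ⊎ u ≢ v
≡⊎≢ u v with u ≟F v
... | yes e = inj₁ e
... | no ne = inj₂ ne

∣∣≤suc∣─∣ : (p : Sub n) (v : Fin n) → ∣ p ∣ ≤ suc ∣ p ─ v ∣
∣∣≤suc∣─∣ p v = cover₁ p (p ─ v) v split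
  where
  split : ∀ i → i ∈ p → i ≡ v ⊎ i ∈ (p ─ v)
  split i i∈p with ≡⊎≢ i v
  ... | inj₁ e  = inj₁ e
  ... | inj₂ ne = inj₂ (∈─ p i∈p ne)

∣∣≤1⇒≡ : (p : Sub n) → ∣ p ∣ ≤ 1 → ∀ {u v} → u ∈ p → v ∈ p → u ≡ v
∣∣≤1⇒≡ p ≤1 {u} {v} u∈p v∈p with ≡⊎≢ u v
... | inj₁ e  = e
... | inj₂ ne = ⊥-elim (<⇒≱ (≤-trans (s≤s (pack₁ (λ _ → false) (p ─ v) u (∈─ p u∈p ne) (λ _ ()) (λ ())))
                 (pack₁ (p ─ v) p v v∈p (─⊆ p v) (∉─ p v))) (≤-trans ≤1 (s≤s z≤n)))

pick : (p : Sub n) → 1 ≤ ∣ p ∣ → ∃ λ v → v ∈ p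
pick p 1≤p with any? (λ v → p v ≟ᵇ true)
... | yes found = found
... | no  none  = ⊥-elim (<⇒≱ 1≤p (≤-reflexive (∣∣≡0 p λ i e → none (i , e))))

pick-≢ : (p : Sub n) (v : Fin n) → 2 ≤ ∣ p ∣ → ∃ λ u → u ∈ p × u ≢ v
pick-≢ p v 2≤p with u , u∈ ← pick (p ─ v) (s≤s⁻¹ (≤-trans 2≤p (∣∣≤suc∣─∣ p v))) =
  u , ─⊆ p v u u∈ , ∈─⇒≢ p u∈

pick-≢≢ : (p : Sub n) (v w : Fin n) → 3 ≤ ∣ p ∣ → ∃ λ u → u ∈ p × u ≢ v × u ≢ w
pick-≢≢ p v w 3≤p with u , u∈ , u≢w ← pick-≢ (p ─ v) w (s≤s⁻¹ (≤-trans 3≤p (∣∣≤suc∣─∣ p v))) =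
  u , ─⊆ p v u u∈ , ∈─⇒≢ p u∈ , u≢w

pick-many : (p : Sub n) (r : ℕ) → r ≤ ∣ p ∣ →
  ∃ λ vs → length vs ≡ r × Unique vs × All (_∈ p) vs
pick-many p zero    _   = [] , refl , [] , []
pick-many p (suc r) r<p
  with v , v∈p ← pick p (≤-trans (s≤s z≤n) r<p)
  with vs , len , uniq , vs⊆ ← pick-many (p ─ v) r (s≤s⁻¹ (≤-trans r<p (∣∣≤suc∣─∣ p v)))
  = v ∷ vs , cong suc len , All.map (≢-sym ∘ ∈─⇒≢ p) vs⊆ ∷ uniq , v∈p ∷ All.map (λ {i} → ─⊆ p v i) vs⊆

search : (A : Sub n) (f : Fin n → ℕ) (t : ℕ) →
  (∃ λ a → a ∈ A × t ≤ f a) ⊎ (∀ a → a ∈ A → f a < t)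
search A f t with any? (λ a → (A a ≟ᵇ true) ×-dec (t ≤? f a))
... | yes found = inj₁ found
... | no  none  = inj₂ λ a a∈A → ≰⇒> λ t≤ → none (a , a∈A , t≤)

search₂ : (A : Sub n) (B : Fin n → Sub n) →
  (∃₂ λ a b → a ∈ A × b ∈ B a) ⊎ (∀ a b → a ∈ A → b ∉ B a)
search₂ A B with any? (λ a → any? (λ b → (A a ≟ᵇ true) ×-dec (B a b ≟ᵇ true)))
... | yes found = inj₁ found
... | no  none  = inj₂ λ a b a∈A b∈B → none (a , b , a∈A , b∈B)

-- Count the edges between `A` and `B`: the side of `B` gives at least `t * ∣ B ∣`, the side of `A`
-- at most `∣ A ∣`.
double-count : (E : Fin n → Fin n → Bool) → (∀ u v → E u v ≡ E v u) → (A B : Sub n) (t : ℕ) →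
  (∀ a → a ∈ A → ∣ B ∩ E a ∣ ≤ 1) → (∀ b → b ∈ B → t ≤ ∣ A ∩ E b ∣) → t * ∣ B ∣ ≤ ∣ A ∣
double-count E E-sym A B t A≤1 t≤B = begin
  t * ∣ B ∣                                      ≡⟨ sum-*-distribˡ t (indicator ∘ B) ⟩
  sum (λ b → t * indicator (B b))                ≤⟨ sum-mono below ⟩
  sum (λ b → sum λ a → indicator (edge a b))     ≡⟨ ∑-comm (λ b a → indicator (edge a b)) ⟩
  sum (λ a → sum λ b → indicator (edge a b))     ≤⟨ sum-mono above ⟩
  ∣ A ∣                                          ∎
  where
  open ≤-Reasoning
  edge : _ → _ → Bool
  edge a b = A a ∧ (B b ∧ E a b)
  below : ∀ b → t * indicator (B b) ≤ sum (λ a → indicator (edge a b))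
  below b with B b in b∈B
  ... | false = ≤-trans (≤-reflexive (*-zeroʳ t)) z≤n
  ... | true  = ≤-trans (≤-reflexive (*-identityʳ t)) (≤-trans (t≤B b b∈B)
    (∣∣-mono (A ∩ E b) (λ a → A a ∧ E a b) λ a a∈ →
      ∧-intro (∧-elimˡ a∈) (trans (E-sym a b) (∧-elimʳ {A a} a∈))))
  above : ∀ a → sum (λ b → indicator (edge a b)) ≤ indicator (A a)
  above a with A a in a∈A
  ... | false = ≤-reflexive (sum-zero {f = λ b → indicator (false ∧ (B b ∧ E a b))} λ _ → refl)
  ... | true  = A≤1 a a∈A

-- Embedding the trees

-- Total by means of a default, so that lists are indexed by the same plain numbers as the vertices
-- in `broomEdge`.
nth : X → List X → ℕ → X
nth d []       _       = d
nth d (x ∷ xs) zero    = x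
nth d (x ∷ xs) (suc i) = nth d xs i

nth-++ : (d : X) (xs zs : List X) (i : ℕ) → nth d (xs ++ zs) (i + length xs) ≡ nth d zs i
nth-++ d []       zs i = cong (nth d zs) (+-identityʳ i)
nth-++ d (x ∷ xs) zs i = trans (cong (nth d (x ∷ xs ++ zs)) (+-suc i (length xs))) (nth-++ d xs zs i)

nth-All : {P : X → Set} (d : X) {xs : List X} → All P xs → ∀ {i} → i < length xs → P (nth d xs i)
nth-All d (px ∷ _)   {zero}  _   = px
nth-All d (_  ∷ pxs) {suc i} i<  = nth-All d pxs (s≤s⁻¹ i<)

nth-injective : (d : X) {xs : List X} → Unique xs → ∀ {i j} → i < length xs → j < length xs →
  nth d xs i ≡ nth d xs j → i ≡ j
nth-injective d (_ ∷ _)   {zero}  {zero}  _  _  _ = refl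
nth-injective d (x∉ ∷ _)  {zero}  {suc j} _  j< e = ⊥-elim (nth-All d x∉ (s≤s⁻¹ j<) e)
nth-injective d (x∉ ∷ _)  {suc i} {zero}  i< _  e = ⊥-elim (nth-All d x∉ (s≤s⁻¹ i<) (sym e))
nth-injective d (_ ∷ uxs) {suc i} {suc j} i< j< e =
  cong suc (nth-injective d uxs (s≤s⁻¹ i<) (s≤s⁻¹ j<) e)

∨-elim : ∀ {x y} → x ∨ y ≡ true → x ≡ true ⊎ y ≡ true
∨-elim {true}  _ = inj₁ refl
∨-elim {false} e = inj₂ e

≡ᵇ-true⇒≡ : ∀ a b → (a ≡ᵇ b) ≡ true → a ≡ b
≡ᵇ-true⇒≡ a b e = ≡ᵇ⇒≡ a b (Equivalence.from T-≡ e)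

≤ᵇ-true⇒≤ : ∀ a b → (a ≤ᵇ b) ≡ true → a ≤ b
≤ᵇ-true⇒≤ a b e = ≤ᵇ⇒≤ a b (Equivalence.from T-≡ e)

-- The three trees of the paper differ only in the two positions p and q to which the last
-- two vertices are attached.
broomEdge : (s p q : ℕ) → ℕ → ℕ → Bool
broomEdge s p q a b =
  ((a ≡ᵇ 0) ∧ inRange b (s ∸ 3))
  ∨ ((a ≡ᵇ p) ∧ (b ≡ᵇ (s ∸ 2)))
  ∨ ((a ≡ᵇ q) ∧ (b ≡ᵇ (s ∸ 1)))

broom : (s p q : ℕ) → Graph s
broom s p q = fromEdges s (broomEdge s p q)

data Shape : Set where
  double cherry path : Shape

treeOf : Shape → (s : ℕ) → Graph s
treeOf double = T¹
treeOf cherry = T²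
treeOf path   = T*

shapeOf : Idx → Shape
shapeOf one = double
shapeOf two = cherry

-- Here `a` and `b` stand for the tree vertices numbered s - 4 and s - 3, both adjacent to the
-- centre, and `x` and `y` for the last two, s - 2 and s - 1.
Attached : Shape → Graph n → (a b x y : Fin n) → Set
Attached double G a b x y = G a x ≡ true × G b y ≡ true
Attached cherry G a b x y = G b x ≡ true × G b y ≡ true
Attached path   G a b x y = G b x ≡ true × G x y ≡ true

module Embedding {n} (G : Graph n) (G-sym : ∀ u v → G u v ≡ G v u) where

  -- The list `L` enumerates the images in the order of the tree vertices, centre first, so that
  -- vertex `i` goes to `nth c L i`.
  embed-broom : ∀ {r} (c a b x y : Fin n) (vs : List (Fin n)) (p q : ℕ) →
    length vs ≡ r →
    let L = c ∷ vs ++ a ∷ b ∷ x ∷ y ∷ [] in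
    Unique L → All (_∈ G c) vs → a ∈ G c → b ∈ G c →
    G (nth c L p) x ≡ true → G (nth c L q) y ≡ true →
    Contains G (broom (5 + r) p q)
  embed-broom c a b x y vs p q refl uniq vs~c a~c b~c px qy =
      f
    , (λ {i} {j} e → toℕ-injective (nth-injective c uniq (bound i) (bound j) e))
    , edge
    where
    tail′ = a ∷ b ∷ x ∷ y ∷ []
    L = c ∷ vs ++ tail′
    f : Fin (5 + length vs) → Fin n
    f i = nth c L (toℕ i)
    len : length L ≡ 5 + length vs
    len = cong suc (trans (length-++ vs) (+-comm (length vs) 4))
    bound : ∀ i → toℕ i < length L
    bound i = subst (toℕ i <_) (sym len) (toℕ<n i)
    atx : nth c L (3 + length vs) ≡ x
    atx = nth-++ c vs tail′ 2
    aty : nth c L (4 + length vs) ≡ y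
    aty = nth-++ c vs tail′ 3
    leaf : ∀ j → 1 ≤ j → j ≤ 2 + length vs → G c (nth c L j) ≡ true
    leaf (suc j) _ j≤ = go vs vs~c j (s≤s⁻¹ j≤)
      where
      go : ∀ ws → All (_∈ G c) ws → ∀ j → j ≤ 1 + length ws → nth c (ws ++ tail′) j ∈ G c
      go []       _          zero          _  = a~c
      go []       _          (suc zero)    _  = b~c
      go []       _          (suc (suc j)) (s≤s ())
      go (w ∷ ws) (w~c ∷ _)  zero          _  = w~c
      go (w ∷ ws) (_ ∷ ws~c) (suc j)       j≤ = go ws ws~c j (s≤s⁻¹ j≤)
    directed : ∀ i j → broomEdge (5 + length vs) p q i j ≡ true → G (nth c L i) (nth c L j) ≡ true
    directed i j e with ∨-elim e
    ... | inj₁ e₁ with refl ← ≡ᵇ-true⇒≡ i 0 (∧-elimˡ e₁) =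
      let r = ∧-elimʳ {i ≡ᵇ 0} e₁ in
      leaf j (≤ᵇ-true⇒≤ 1 j (∧-elimˡ r)) (≤ᵇ-true⇒≤ j (2 + length vs) (∧-elimʳ {1 ≤ᵇ j} r))
    ... | inj₂ e₂ with ∨-elim e₂
    ...   | inj₁ e₃ with refl ← ≡ᵇ-true⇒≡ i p (∧-elimˡ e₃)
                    with refl ← ≡ᵇ-true⇒≡ j (3 + length vs) (∧-elimʳ {i ≡ᵇ p} e₃) =
      subst (λ z → G (nth c L p) z ≡ true) (sym atx) px
    ...   | inj₂ e₃ with refl ← ≡ᵇ-true⇒≡ i q (∧-elimˡ e₃)
                    with refl ← ≡ᵇ-true⇒≡ j (4 + length vs) (∧-elimʳ {i ≡ᵇ q} e₃) =
      subst (λ z → G (nth c L q) z ≡ true) (sym aty) qy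
    edge : ∀ u v → broom (5 + length vs) p q u v ≡ true → G (f u) (f v) ≡ true
    edge u v e with ∨-elim e
    ... | inj₁ e′ = directed (toℕ u) (toℕ v) e′
    ... | inj₂ e′ = trans (G-sym (f u) (f v)) (directed (toℕ v) (toℕ u) e′)

  module _ (G-irr : ∀ u → G u u ≡ false) where

    adjacent⇒≢ : ∀ {u v} → G u v ≡ true → u ≢ v
    adjacent⇒≢ {u} e refl with () ← trans (sym e) (G-irr u)

    -- `S` is a reservoir of neighbours of `c`, disjoint from the four special vertices, from which
    -- the other `r` leaves are drawn.
    embed-tree : ∀ {r} (sh : Shape) (c a b x y : Fin n) (S : Sub n) →
      Attached sh G a b x y → a ∈ G c → b ∈ G c → c ≢ x → c ≢ y →
      Unique (a ∷ b ∷ x ∷ y ∷ []) → S ⊆ G c →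
      All (_∉ S) (a ∷ b ∷ x ∷ y ∷ []) → r ≤ ∣ S ∣ → Contains G (treeOf sh (5 + r))
    embed-tree {r} sh c a b x y S att a~c b~c c≢x c≢y uniq S⊆ out r≤
      with vs , len , vs-uniq , vs⊆S ← pick-many S r r≤ = finish sh att
      where
      tail′ = a ∷ b ∷ x ∷ y ∷ []
      L = c ∷ vs ++ tail′
      vs~c : All (_∈ G c) vs
      vs~c = All.map (λ {i} → S⊆ i) vs⊆S
      L-uniq : Unique L
      L-uniq =
        All.++⁺ (All.map adjacent⇒≢ vs~c) (adjacent⇒≢ a~c ∷ adjacent⇒≢ b~c ∷ c≢x ∷ c≢y ∷ [])
        ∷ AllPairs.++⁺ vs-uniq uniq
            (All.map (λ {v} v∈S → All.map (λ {w} w∉S v≡w → w∉S (subst (_∈ S) v≡w v∈S)) out) vs⊆S)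
      build : ∀ p q → G (nth c L p) x ≡ true → G (nth c L q) y ≡ true → Contains G (broom (5 + r) p q)
      build p q = embed-broom c a b x y vs p q len L-uniq vs~c a~c b~c
      at : ∀ i {z w} → nth c tail′ i ≡ z → G z w ≡ true → G (nth c L (suc i + r)) w ≡ true
      at i {w = w} refl e = subst (λ z → G z w ≡ true)
        (sym (trans (cong (λ k → nth c (vs ++ tail′) (i + k)) (sym len)) (nth-++ c vs tail′ i))) e
      finish : ∀ sh → Attached sh G a b x y → Contains G (treeOf sh (5 + r))
      -- For s = 5 + r the positions s - 4, s - 3 and s - 2 compute to `1 + r`, `2 + r` and `3 + r`,
      -- so these brooms are the trees by definition.
      finish double (ax , by) = build (1 + r) (2 + r) (at 0 refl ax) (at 1 refl by)
      finish cherry (bx , by) = build (2 + r) (2 + r) (at 1 refl bx) (at 1 refl by)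
      finish path   (bx , xy) = build (2 + r) (3 + r) (at 1 refl bx) (at 2 refl xy)

    -- In `cherry` and `path` the leaf `a` carries nothing, so any element of `S` can play its part;
    -- hence the bound `suc r`.
    embed-stem : ∀ {r} (sh : Shape) (c b x y : Fin n) (S : Sub n) →
      (∀ a → Attached sh G a b x y) → b ∈ G c → c ≢ x → c ≢ y →
      Unique (b ∷ x ∷ y ∷ []) → S ⊆ G c →
      All (_∉ S) (b ∷ x ∷ y ∷ []) → suc r ≤ ∣ S ∣ → Contains G (treeOf sh (5 + r))
    embed-stem sh c b x y S att b~c c≢x c≢y uniq S⊆ out r<
      with a , a∈S ← pick S (≤-trans (s≤s z≤n) r<) =
      embed-tree sh c a b x y (S ─ a) (att a) (S⊆ a a∈S) b~c c≢x c≢y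
        (All.map (λ w∉S a≡w → w∉S (subst (_∈ S) a≡w a∈S)) out ∷ uniq)
        (λ i → S⊆ i ∘ ─⊆ S a i)
        (∉─ S a ∷ All.map (λ {w} w∉S → w∉S ∘ ─⊆ S a w) out)
        (s≤s⁻¹ (≤-trans r< (∣∣≤suc∣─∣ S a)))

    -- A path p q s t among the neighbours of `c` contains every kind of attachment: q and s hang on
    -- p and t for `double`, p and s hang on q for `cherry`, and p q s is the tail for `path`.
    embed-P₄ : ∀ {r} (sh : Shape) (c p q s t : Fin n) (D : Sub n) →
      G p q ≡ true → G q s ≡ true → G s t ≡ true →
      Unique (p ∷ q ∷ s ∷ t ∷ []) → All (_∈ D) (p ∷ q ∷ s ∷ t ∷ []) → D ⊆ G c → 4 + r ≤ ∣ D ∣ →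
      Contains G (treeOf sh (5 + r))
    embed-P₄ {r} sh c p q s t D pq qs st
      ((p≢q ∷ p≢s ∷ p≢t ∷ []) ∷ (q≢s ∷ q≢t ∷ []) ∷ (s≢t ∷ []) ∷ [] ∷ [])
      (p∈ ∷ q∈ ∷ s∈ ∷ t∈ ∷ []) D⊆ 4+r≤ = build sh
      where
      c≢ : ∀ {u} → u ∈ D → c ≢ u
      c≢ u∈ = adjacent⇒≢ (D⊆ _ u∈)
      S₃ = D ─ p ─ q ─ s
      S₃⊆D : S₃ ⊆ D
      S₃⊆D i = ─⊆ D p i ∘ ─⊆ (D ─ p) q i ∘ ─⊆ (D ─ p ─ q) s i
      p∉ : p ∉ S₃
      p∉ = ∉─ D p ∘ ─⊆ (D ─ p) q p ∘ ─⊆ (D ─ p ─ q) s p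
      q∉ : q ∉ S₃
      q∉ = ∉─ (D ─ p) q ∘ ─⊆ (D ─ p ─ q) s q
      s∉ : s ∉ S₃
      s∉ = ∉─ (D ─ p ─ q) s
      big₃ : suc r ≤ ∣ S₃ ∣
      big₃ = s≤s⁻¹ (s≤s⁻¹ (s≤s⁻¹ (≤-trans 4+r≤ (≤-trans (∣∣≤suc∣─∣ D p)
        (s≤s (≤-trans (∣∣≤suc∣─∣ (D ─ p) q) (s≤s (∣∣≤suc∣─∣ (D ─ p ─ q) s))))))))
      build : ∀ sh → Contains G (treeOf sh (5 + r))
      build double = embed-tree double c p t q s (S₃ ─ t) (pq , trans (G-sym t s) st)
        (D⊆ p p∈) (D⊆ t t∈) (c≢ q∈) (c≢ s∈)
        ((p≢t ∷ p≢q ∷ p≢s ∷ []) ∷ (≢-sym q≢t ∷ ≢-sym s≢t ∷ []) ∷ (q≢s ∷ []) ∷ [] ∷ [])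
        (λ i → D⊆ i ∘ S₃⊆D i ∘ ─⊆ S₃ t i)
        (p∉ ∘ ─⊆ S₃ t p ∷ ∉─ S₃ t ∷ q∉ ∘ ─⊆ S₃ t q ∷ s∉ ∘ ─⊆ S₃ t s ∷ [])
        (s≤s⁻¹ (≤-trans big₃ (∣∣≤suc∣─∣ S₃ t)))
      build cherry = embed-stem cherry c q p s S₃ (λ _ → trans (G-sym q p) pq , qs)
        (D⊆ q q∈) (c≢ p∈) (c≢ s∈)
        ((≢-sym p≢q ∷ q≢s ∷ []) ∷ (p≢s ∷ []) ∷ [] ∷ [])
        (λ i → D⊆ i ∘ S₃⊆D i) (q∉ ∷ p∉ ∷ s∉ ∷ []) big₃
      build path = embed-stem path c p q s S₃ (λ _ → pq , qs)
        (D⊆ p p∈) (c≢ q∈) (c≢ s∈)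
        ((p≢q ∷ p≢s ∷ []) ∷ (q≢s ∷ []) ∷ [] ∷ [])
        (λ i → D⊆ i ∘ S₃⊆D i) (p∉ ∷ q∉ ∷ s∉ ∷ []) big₃

    -- Minimum degree 3 inside D yields a path on four vertices in D.
    embed-dense : ∀ {r} (sh : Shape) (c : Fin n) (D : Sub n) → D ⊆ G c → 4 + r ≤ ∣ D ∣ →
      (∀ u → u ∈ D → 3 ≤ ∣ D ∩ G u ∣) → Contains G (treeOf sh (5 + r))
    embed-dense sh c D D⊆ 4+r≤ deg
      with p , p∈ ← pick D (≤-trans (s≤s z≤n) 4+r≤)
      with q , q∈ ← pick (D ∩ G p) (≤-trans (s≤s z≤n) (deg p p∈))
      with s , s∈ , s≢p ← pick-≢ (D ∩ G q) p (≤-trans (s≤s (s≤s z≤n)) (deg q (∧-elimˡ q∈)))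
      with t , t∈ , t≢p , t≢q ← pick-≢≢ (D ∩ G s) p q (deg s (∧-elimˡ s∈)) =
      embed-P₄ sh c p q s t D pq qs st
        ((adjacent⇒≢ pq ∷ ≢-sym s≢p ∷ ≢-sym t≢p ∷ []) ∷ (adjacent⇒≢ qs ∷ ≢-sym t≢q ∷ [])
          ∷ (adjacent⇒≢ st ∷ []) ∷ [] ∷ [])
        (p∈ ∷ ∧-elimˡ q∈ ∷ ∧-elimˡ s∈ ∷ ∧-elimˡ t∈ ∷ []) D⊆ 4+r≤
      where
      pq = ∧-elimʳ {D q} q∈
      qs = ∧-elimʳ {D s} s∈
      st = ∧-elimʳ {D t} t∈

-- The upper bound

-- (1 + t) b ≤ k + t ≤ 2 t + b forces t b ≤ 2 t.
double-count-bound : ∀ {k t b} → 1 ≤ t → 3 ≤ b → k ≤ t + b → ¬ (suc t * b ≤ k + t)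
double-count-bound {k} {t} {b} 1≤t 3≤b k≤ h = <⇒≱ t<t*b (+-cancelˡ-≤ b _ _ (begin
  b + t * b    ≤⟨ h ⟩
  k + t        ≤⟨ +-monoˡ-≤ t k≤ ⟩
  t + b + t    ≡⟨ regroup t b ⟩
  b + (t + t)  ∎))
  where
  open ≤-Reasoning
  regroup : ∀ t b → t + b + t ≡ b + (t + t)
  regroup = solve-∀
  triple : ∀ t → t + (t + t) ≡ t * 3
  triple = solve-∀
  t<t*b : t + t < t * b
  t<t*b = begin-strict
    t + t        <⟨ m<n+m (t + t) 1≤t ⟩
    t + (t + t)  ≡⟨ triple t ⟩
    t * 3        ≤⟨ *-monoʳ-≤ t 3≤b ⟩
    t * b        ∎

-- Here m = 5 + r, so that k = m − 3.
module Upper (r : ℕ) (7≤r : 7 ≤ r) where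

  k : ℕ
  k = 2 + r

  9≤k : 9 ≤ k
  9≤k = s≤s (s≤s 7≤r)

  module Colouring {n : ℕ} (n≡ : n ≡ suc (k + k)) (R B : Graph n)
    (R-sym : ∀ u v → R u v ≡ R v u) (R-irr : ∀ u → R u u ≡ false)
    (B-sym : ∀ u v → B u v ≡ B v u) (B-irr : ∀ u → B u u ≡ false)
    (B⇒¬R : ∀ {u v} → B u v ≡ true → ¬ (R u v ≡ true))
    (R⊎B : ∀ {u v} → u ≢ v → R u v ≡ true ⊎ B u v ≡ true) where

    R-symm : ∀ {u v} → R u v ≡ true → R v u ≡ true
    R-symm {u} {v} = trans (R-sym v u)

    module ER = Embedding R R-sym
    module EB = Embedding B B-sym

    B⇒≢ : ∀ {u v} → B u v ≡ true → u ≢ v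
    B⇒≢ = EB.adjacent⇒≢ B-irr

    R⇒≢ : ∀ {u v} → R u v ≡ true → u ≢ v
    R⇒≢ = ER.adjacent⇒≢ R-irr

    -- The extra 1 pays for `u` itself, in case it lies in `S`; `nbr-split∉` saves it.
    nbr-split : ∀ S u → ∣ S ∣ ≤ suc (∣ S ∩ R u ∣ + ∣ S ∩ B u ∣)
    nbr-split S u = ≤-trans (∣∣≤suc∣─∣ S u) (s≤s (cover (S ─ u) (S ∩ R u) (S ∩ B u) h))
      where
      h : ∀ i → i ∈ (S ─ u) → i ∈ (S ∩ R u) ⊎ i ∈ (S ∩ B u)
      h i i∈ with R⊎B (≢-sym (∈─⇒≢ S i∈))
      ... | inj₁ e = inj₁ (∧-intro (─⊆ S u i i∈) e)
      ... | inj₂ e = inj₂ (∧-intro (─⊆ S u i i∈) e)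

    nbr-split∉ : ∀ S u → u ∉ S → ∣ S ∣ ≤ ∣ S ∩ R u ∣ + ∣ S ∩ B u ∣
    nbr-split∉ S u u∉S = cover S (S ∩ R u) (S ∩ B u) h
      where
      h : ∀ i → i ∈ S → i ∈ (S ∩ R u) ⊎ i ∈ (S ∩ B u)
      h i i∈ with R⊎B {u} {i} (λ { refl → u∉S i∈ })
      ... | inj₁ e = inj₁ (∧-intro i∈ e)
      ... | inj₂ e = inj₂ (∧-intro i∈ e)

    degree-sum : ∀ u → k + k ≤ ∣ R u ∣ + ∣ B u ∣
    degree-sum u = s≤s⁻¹ (subst (_≤ suc (∣ R u ∣ + ∣ B u ∣)) (trans (∣⊤∣ n) n≡) (nbr-split (λ _ → true) u))

    module _ (sh : Shape) where

      RedTree : Set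
      RedTree = Contains R (treeOf sh (5 + r))

      -- Any `c` in `C` keeps at least `3 + k` red neighbours in `C`. Among these, a vertex misses
      -- only itself and at most one blue neighbour, so `embed-dense` applies.
      red-from-dense : (C : Sub n) → 5 + k ≤ ∣ C ∣ → (∀ u → u ∈ C → ∣ C ∩ B u ∣ ≤ 1) → RedTree
      red-from-dense C big sparse
        with c , c∈C ← pick C (≤-trans (s≤s z≤n) big) =
        ER.embed-dense R-irr sh c D (λ i → ∧-elimʳ {C i}) (≤-trans (n≤1+n (2 + k)) 3+k≤) deg
        where
        D = C ∩ R c
        3+k≤ : 3 + k ≤ ∣ D ∣
        3+k≤ = +-cancelʳ-≤ 1 _ _ (s≤s⁻¹ (begin
          suc (3 + k + 1)                   ≡⟨ cong suc (+-comm (3 + k) 1) ⟩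
          5 + k                             ≤⟨ big ⟩
          ∣ C ∣                             ≤⟨ nbr-split C c ⟩
          suc (∣ D ∣ + ∣ C ∩ B c ∣)         ≤⟨ s≤s (+-monoʳ-≤ ∣ D ∣ (sparse c c∈C)) ⟩
          suc (∣ D ∣ + 1)                   ∎))
          where open ≤-Reasoning
        deg : ∀ u → u ∈ D → 3 ≤ ∣ D ∩ R u ∣
        deg u u∈D = +-cancelʳ-≤ 1 _ _ (s≤s⁻¹ (begin
          5                                    ≤⟨ ≤-trans (m≤m+n 5 r) 3+k≤ ⟩
          ∣ D ∣                                ≤⟨ nbr-split D u ⟩
          suc (∣ D ∩ R u ∣ + ∣ D ∩ B u ∣)      ≤⟨ s≤s (+-monoʳ-≤ ∣ D ∩ R u ∣
            (≤-trans (∣∣-mono (D ∩ B u) (C ∩ B u) (λ i e → ∧-intro (∧-elimˡ {C i} (∧-elimˡ e)) (∧-elimʳ {D i} e)))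
                     (sparse u (∧-elimˡ u∈D)))) ⟩
          suc (∣ D ∩ R u ∣ + 1)                ∎))
          where open ≤-Reasoning

      -- A vertex of large blue degree

      module _ (v : Fin n) where

        -- Two disjoint blue edges inside `B v` give the blue `T¹`, and a vertex with two blue
        -- neighbours inside `B v` gives the blue `T²`. Otherwise `B v`, for `T¹` possibly after
        -- removing both ends of one blue edge, has blue degrees at most 1. These two vertices are
        -- the difference between `7 + k` and `5 + k`.
        few-red-neighbours : ∀ j → 7 + k ≤ ∣ B v ∣ → Contains B (T j (6 + r)) ⊎ RedTree
        few-red-neighbours two big with search (B v) (λ a → ∣ B v ∩ B a ∣) 2
        ... | inj₂ sparse = inj₂ (red-from-dense (B v) (≤-trans (m≤n+m _ 2) big) (λ u u∈ → s≤s⁻¹ (sparse u u∈)))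
        ... | inj₁ (a , a∈ , 2≤)
          with x , x∈ ← pick (B v ∩ B a) (≤-trans (s≤s z≤n) 2≤)
          with y , y∈ , y≢x ← pick-≢ (B v ∩ B a) x 2≤ =
          -- The blue tree has `6 + r` vertices, so blue embeddings run with `suc r` in place of
          -- `r`.
          inj₁ (EB.embed-stem B-irr cherry v a x y S (λ _ → ax , ay) a∈
            (B⇒≢ (∧-elimˡ x∈)) (B⇒≢ (∧-elimˡ y∈))
            ((B⇒≢ ax ∷ B⇒≢ ay ∷ []) ∷ (≢-sym y≢x ∷ []) ∷ [] ∷ [])
            (λ i → ─⊆ A a i ∘ ─⊆ (A ─ a) x i ∘ ─⊆ (A ─ a ─ x) y i)
            (∉─ A a ∘ ─⊆ (A ─ a) x a ∘ ─⊆ (A ─ a ─ x) y a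
              ∷ ∉─ (A ─ a) x ∘ ─⊆ (A ─ a ─ x) y x ∷ ∉─ (A ─ a ─ x) y ∷ [])
            (s≤s⁻¹ (s≤s⁻¹ (s≤s⁻¹ (≤-trans (m≤n+m _ 4) (≤-trans big (≤-trans (∣∣≤suc∣─∣ A a)
              (s≤s (≤-trans (∣∣≤suc∣─∣ (A ─ a) x) (s≤s (∣∣≤suc∣─∣ (A ─ a ─ x) y)))))))))))
          where
          A = B v
          S = A ─ a ─ x ─ y
          ax = ∧-elimʳ {B v x} x∈
          ay = ∧-elimʳ {B v y} y∈
        few-red-neighbours one big with search₂ (B v) (λ a → B v ∩ B a)
        ... | inj₂ none = inj₂ (red-from-dense (B v) (≤-trans (m≤n+m _ 2) big)
                (λ u u∈ → ≤-trans (≤-reflexive (∣∣≡0 (B v ∩ B u) (λ i → none u i u∈))) z≤n))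
        ... | inj₁ (x , y , x∈ , y∈′) with search₂ (B v ─ x ─ y) (λ a → (B v ─ x ─ y) ∩ B a)
        ...   | inj₂ none = inj₂ (red-from-dense A′ (s≤s⁻¹ (s≤s⁻¹ (≤-trans big (≤-trans (∣∣≤suc∣─∣ (B v) x) (s≤s (∣∣≤suc∣─∣ (B v ─ x) y))))))
                (λ u u∈ → ≤-trans (≤-reflexive (∣∣≡0 (A′ ∩ B u) (λ i → none u i u∈))) z≤n))
          where A′ = B v ─ x ─ y
        ...   | inj₁ (z , w , z∈ , w∈) =
          inj₁ (EB.embed-tree B-irr double v x z y w S (∧-elimʳ {B v y} y∈′ , zw) x∈ z∈A (B⇒≢ y∈A) (B⇒≢ w∈A)
            ((≢-sym (∈─⇒≢ A (─⊆ (A ─ x) y z z∈)) ∷ B⇒≢ (∧-elimʳ {B v y} y∈′) ∷ ≢-sym (∈─⇒≢ A (─⊆ (A ─ x) y w w∈′)) ∷ [])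
             ∷ (∈─⇒≢ (A ─ x) z∈ ∷ B⇒≢ zw ∷ []) ∷ (≢-sym (∈─⇒≢ (A ─ x) w∈′) ∷ []) ∷ [] ∷ [])
            (λ i → ─⊆ A x i ∘ ─⊆ (A ─ x) y i ∘ S⊆ i)
            (∉─ A x ∘ ─⊆ (A ─ x) y x ∘ S⊆ x ∷ ∉─ (A ─ x ─ y) z ∘ ─⊆ (A ─ x ─ y ─ z) w z
              ∷ ∉─ (A ─ x) y ∘ S⊆ y ∷ ∉─ (A ─ x ─ y ─ z) w ∷ [])
            (s≤s⁻¹ (s≤s⁻¹ (s≤s⁻¹ (s≤s⁻¹ (≤-trans (m≤n+m _ 4) (≤-trans big (≤-trans (∣∣≤suc∣─∣ A x)
              (s≤s (≤-trans (∣∣≤suc∣─∣ (A ─ x) y) (s≤s (≤-trans (∣∣≤suc∣─∣ (A ─ x ─ y) z)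
                (s≤s (∣∣≤suc∣─∣ (A ─ x ─ y ─ z) w))))))))))))))
          where
          A = B v
          S = A ─ x ─ y ─ z ─ w
          S⊆ : S ⊆ (A ─ x ─ y)
          S⊆ i = ─⊆ (A ─ x ─ y) z i ∘ ─⊆ (A ─ x ─ y ─ z) w i
          w∈′ = ∧-elimˡ {(A ─ x ─ y) w} w∈
          zw = ∧-elimʳ {(A ─ x ─ y) w} w∈
          z∈A = ─⊆ A x z (─⊆ (A ─ x) y z z∈)
          w∈A = ─⊆ A x w (─⊆ (A ─ x) y w w∈′)
          y∈A = ∧-elimˡ {B v y} y∈′

        A≢Z : ∀ {a z} → B v a ≡ true → R v z ≡ true → a ≢ z
        A≢Z va vz refl = B⇒¬R va vz

        -- A centre z of a red tree with v as a leaf: v reaches z′ and a third vertex of R v, and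
        -- the edge a — z′ provides the second attachment.
        Pivot : Set
        Pivot = ∃ λ z → ∃₂ λ a z′ →
          z ∈ R v × k ≤ ∣ B v ∩ R z ∣ × a ∈ (B v ∩ R z) × z′ ∈ R v × R a z′ ≡ true × z′ ≢ z

        -- The leaves of `z` are `v` and vertices of `B v`. For `double`, `a` carries `z′` and `v`
        -- carries a third vertex `z″` of `R v`; for `cherry`, `v` carries both; for `path`, the
        -- tail is v, z′, a, and `a` is withdrawn from the leaves.
        red-from-pivot : 3 ≤ ∣ R v ∣ → Pivot → RedTree
        red-from-pivot 3≤ (z , a , z′ , vz , k≤ , a∈ , vz′ , az′ , z′≢z)
          with z″ , vz″ , z″≢z , z″≢z′ ← pick-≢≢ (R v) z z′ 3≤ = build sh
          where
          S = B v ∩ R z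
          va = ∧-elimˡ {B v a} a∈
          za = ∧-elimʳ {B v a} a∈
          big : suc r ≤ ∣ S ─ a ∣
          big = s≤s⁻¹ (≤-trans k≤ (∣∣≤suc∣─∣ S a))
          Z∉S : ∀ {w} → w ∈ R v → w ∉ S
          Z∉S {w} vw w∈S = B⇒¬R (∧-elimˡ {B v w} w∈S) vw
          v∉S : v ∉ S
          v∉S v∈S = B⇒≢ (∧-elimˡ {B v v} v∈S) refl
          S⊆ : S ⊆ R z
          S⊆ i = ∧-elimʳ {B v i}
          build : ∀ sh → Contains R (treeOf sh (5 + r))
          build double = ER.embed-tree R-irr double z a v z′ z″ (S ─ a) (az′ , vz″)
            za (R-symm vz) (≢-sym z′≢z) (≢-sym z″≢z)
            ((≢-sym (B⇒≢ va) ∷ R⇒≢ az′ ∷ A≢Z va vz″ ∷ []) ∷ (R⇒≢ vz′ ∷ R⇒≢ vz″ ∷ [])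
              ∷ (≢-sym z″≢z′ ∷ []) ∷ [] ∷ [])
            (λ i → S⊆ i ∘ ─⊆ S a i)
            (∉─ S a ∷ v∉S ∘ ─⊆ S a v ∷ Z∉S vz′ ∘ ─⊆ S a z′ ∷ Z∉S vz″ ∘ ─⊆ S a z″ ∷ [])
            (≤-trans (n≤1+n r) big)
          build cherry = ER.embed-stem R-irr cherry z v z′ z″ S (λ _ → vz′ , vz″)
            (R-symm vz) (≢-sym z′≢z) (≢-sym z″≢z)
            ((R⇒≢ vz′ ∷ R⇒≢ vz″ ∷ []) ∷ (≢-sym z″≢z′ ∷ []) ∷ [] ∷ [])
            S⊆ (v∉S ∷ Z∉S vz′ ∷ Z∉S vz″ ∷ []) (≤-trans (n≤1+n (suc r)) k≤)
          build path = ER.embed-stem R-irr path z v z′ a (S ─ a) (λ _ → vz′ , R-symm az′)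
            (R-symm vz) (≢-sym z′≢z) (R⇒≢ za)
            ((R⇒≢ vz′ ∷ B⇒≢ va ∷ []) ∷ (≢-sym (R⇒≢ az′) ∷ []) ∷ [] ∷ [])
            (λ i → S⊆ i ∘ ─⊆ S a i)
            (v∉S ∘ ─⊆ S a v ∷ Z∉S vz′ ∘ ─⊆ S a z′ ∷ ∉─ S a ∷ []) big

        -- Every vertex of `R v` other than `z₀` is red to all of `B v` except perhaps `a₀`, hence
        -- to `k` vertices. Three vertices in `R v` leave room for both `z` and `z′`.
        pivot-off : ∀ a₀ z₀ → suc k ≤ ∣ B v ∣ → 3 ≤ ∣ R v ∣ →
          (∀ a z → a ∈ (B v ─ a₀) → z ∉ ((R v ─ z₀) ∩ B a)) → Pivot
        pivot-off a₀ z₀ k< 3≤ none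
          with z , vz , z≢z₀ ← pick-≢ (R v) z₀ (≤-trans (s≤s (s≤s z≤n)) 3≤)
          with z′ , vz′ , z′≢z₀ , z′≢z ← pick-≢≢ (R v) z₀ z 3≤
          with a , va , a≢a₀ ← pick-≢ (B v) a₀ (≤-trans (s≤s (s≤s z≤n)) k<) =
          z , a , z′ , vz ,
          s≤s⁻¹ (≤-trans k< (cover₁ (B v) (B v ∩ R z) a₀ h)) ,
          ∧-intro va (R-symm (red a z va vz a≢a₀ z≢z₀)) , vz′ , red a z′ va vz′ a≢a₀ z′≢z₀ , z′≢z
          where
          red : ∀ a z → a ∈ B v → z ∈ R v → a ≢ a₀ → z ≢ z₀ → R a z ≡ true
          red a z va vz a≢ z≢ with R⊎B (A≢Z va vz)
          ... | inj₁ e = e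
          ... | inj₂ e = ⊥-elim (none a z (∈─ (B v) va a≢) (∧-intro (∈─ (R v) vz z≢) e))
          h : ∀ i → i ∈ B v → i ≡ a₀ ⊎ i ∈ (B v ∩ R z)
          h i vi with ≡⊎≢ i a₀
          ... | inj₁ e = inj₁ e
          ... | inj₂ i≢ = inj₂ (∧-intro vi (R-symm (red i z vi vz i≢ z≢z₀)))

        -- For `T¹`, two disjoint blue edges between `B v` and `R v` give the blue tree, and if all
        -- blue edges meet the ends of one of them `pivot-off` applies. For `T²`, a vertex of `B v`
        -- with two blue neighbours in `R v` gives the tree, and otherwise double counting yields
        -- the pivot.
        blue-or-pivot : ∀ j → suc k ≤ ∣ B v ∣ → 3 ≤ ∣ R v ∣ → Contains B (T j (6 + r)) ⊎ Pivot
        blue-or-pivot one k< 3≤ with search₂ (B v) (λ a → R v ∩ B a)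
        ... | inj₂ none
          -- There is no blue edge at all, so `a₀` and `z₀` are arbitrary.
          with a₀ , _ ← pick (B v) (≤-trans (s≤s z≤n) k<)
          with z₀ , _ ← pick (R v) (≤-trans (s≤s z≤n) 3≤) =
          inj₂ (pivot-off a₀ z₀ k< 3≤ λ a z a∈ z∈ →
            none a z (─⊆ (B v) a₀ a a∈)
              (∧-intro (─⊆ (R v) z₀ z (∧-elimˡ {(R v ─ z₀) z} z∈)) (∧-elimʳ {(R v ─ z₀) z} z∈)))
        ... | inj₁ (a₀ , z₀ , va₀ , z₀∈) with search₂ (B v ─ a₀) (λ a → (R v ─ z₀) ∩ B a)
        ...   | inj₂ none = inj₂ (pivot-off a₀ z₀ k< 3≤ none)
        ...   | inj₁ (a₁ , z₁ , a₁∈ , z₁∈) =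
          inj₁ (EB.embed-tree B-irr double v a₀ a₁ z₀ z₁ S (∧-elimʳ {R v z₀} z₀∈ , ∧-elimʳ {(R v ─ z₀) z₁} z₁∈)
            va₀ va₁ (R⇒≢ vz₀) (R⇒≢ vz₁)
            ((≢-sym (∈─⇒≢ (B v) a₁∈) ∷ A≢Z va₀ vz₀ ∷ A≢Z va₀ vz₁ ∷ []) ∷ (A≢Z va₁ vz₀ ∷ A≢Z va₁ vz₁ ∷ [])
              ∷ (≢-sym (∈─⇒≢ (R v) z₁∈′) ∷ []) ∷ [] ∷ [])
            S⊆
            (∉─ (B v) a₀ ∘ ─⊆ (B v ─ a₀) a₁ a₀ ∷ ∉─ (B v ─ a₀) a₁ ∷ Z∉S vz₀ ∷ Z∉S vz₁ ∷ [])
            (s≤s⁻¹ (s≤s⁻¹ (≤-trans k< (≤-trans (∣∣≤suc∣─∣ (B v) a₀) (s≤s (∣∣≤suc∣─∣ (B v ─ a₀) a₁)))))))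
          where
          S = B v ─ a₀ ─ a₁
          S⊆ : S ⊆ B v
          S⊆ i = ─⊆ (B v) a₀ i ∘ ─⊆ (B v ─ a₀) a₁ i
          z₁∈′ = ∧-elimˡ {(R v ─ z₀) z₁} z₁∈
          vz₀ = ∧-elimˡ {R v z₀} z₀∈
          vz₁ = ─⊆ (R v) z₀ z₁ z₁∈′
          va₁ = ─⊆ (B v) a₀ a₁ a₁∈
          Z∉S : ∀ {w} → w ∈ R v → w ∉ S
          Z∉S {w} vw w∈S = B⇒¬R (S⊆ w w∈S) vw
        blue-or-pivot two k< 3≤ with search (B v) (λ a → ∣ R v ∩ B a ∣) 2
        ... | inj₁ (a , va , 2≤)
          with x , x∈ ← pick (R v ∩ B a) (≤-trans (s≤s z≤n) 2≤)
          with y , y∈ , y≢x ← pick-≢ (R v ∩ B a) x 2≤ =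
          inj₁ (EB.embed-stem B-irr cherry v a x y (B v ─ a) (λ _ → ax , ay) va (R⇒≢ vx) (R⇒≢ vy)
            ((B⇒≢ ax ∷ B⇒≢ ay ∷ []) ∷ (≢-sym y≢x ∷ []) ∷ [] ∷ [])
            (─⊆ (B v) a)
            (∉─ (B v) a ∷ (λ e → B⇒¬R (─⊆ (B v) a x e) vx) ∷ (λ e → B⇒¬R (─⊆ (B v) a y e) vy) ∷ [])
            (s≤s⁻¹ (≤-trans k< (∣∣≤suc∣─∣ (B v) a))))
          where
          vx = ∧-elimˡ {R v x} x∈
          ax = ∧-elimʳ {R v x} x∈
          vy = ∧-elimˡ {R v y} y∈
          ay = ∧-elimʳ {R v y} y∈
        ... | inj₂ sparse with search (R v) (λ z → ∣ B v ∩ R z ∣) k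
        ...   | inj₁ (z , vz , k≤)
          with a , a∈ ← pick (B v ∩ R z) (≤-trans (s≤s z≤n) k≤)
          -- At most one of the three or more vertices of `R v` is blue to `a`, so two are red to it
          -- and one of these differs from `z`.
          with z′ , z′∈ , z′≢z ← pick-≢ (R v ∩ R a) z
                 (+-cancelʳ-≤ 1 _ _ (≤-trans 3≤ (≤-trans (nbr-split∉ (R v) a (B⇒¬R (∧-elimˡ {B v a} a∈)))
                   (+-monoʳ-≤ ∣ R v ∩ R a ∣ (s≤s⁻¹ (sparse a (∧-elimˡ {B v a} a∈))))))) =
          inj₂ (z , a , z′ , vz , k≤ , a∈ , ∧-elimˡ {R v z′} z′∈ , ∧-elimʳ {R v z′} z′∈ , z′≢z)
        -- Write the blue degree of `v` as k + (t + 1). With fewer than `k` red ones, each `z` has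
        -- at least t + 2 blue neighbours in `B v`, so (t + 2) times `∣ R v ∣` is at most k + t + 1.
        ...   | inj₂ few with t , eq ← m≤n⇒∃[o]m+o≡n k< =
          ⊥-elim (double-count-bound {k} {suc t} {∣ R v ∣} (s≤s z≤n) 3≤ k≤
            (subst (suc (suc t) * ∣ R v ∣ ≤_) size
              (double-count B B-sym (B v) (R v) (suc (suc t)) (λ a va → s≤s⁻¹ (sparse a va)) many)))
          where
          size : ∣ B v ∣ ≡ k + suc t
          size = trans (sym eq) (sym (+-suc k t))
          many : ∀ z → z ∈ R v → suc (suc t) ≤ ∣ B v ∩ B z ∣
          many z vz = +-cancelˡ-≤ k _ _ (begin
            k + suc (suc t)                        ≡⟨ +-suc k (suc t) ⟩
            suc (k + suc t)                        ≡⟨ cong suc size ⟨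
            suc ∣ B v ∣                            ≤⟨ s≤s (nbr-split∉ (B v) z (λ e → B⇒¬R e vz)) ⟩
            suc ∣ B v ∩ R z ∣ + ∣ B v ∩ B z ∣      ≤⟨ +-monoˡ-≤ ∣ B v ∩ B z ∣ (few z vz) ⟩
            k + ∣ B v ∩ B z ∣                      ∎)
            where open ≤-Reasoning
          k≤ : k ≤ suc t + ∣ R v ∣
          k≤ = +-cancelˡ-≤ k _ _ (begin
            k + k                    ≤⟨ degree-sum v ⟩
            ∣ R v ∣ + ∣ B v ∣        ≡⟨ cong (∣ R v ∣ +_) size ⟩
            ∣ R v ∣ + (k + suc t)    ≡⟨ regroup ∣ R v ∣ k (suc t) ⟩
            k + (suc t + ∣ R v ∣)    ∎)
            where
            open ≤-Reasoning
            regroup : ∀ x y z → x + (y + z) ≡ y + (z + x)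
            regroup = solve-∀

        blue-vertex : ∀ j → suc k ≤ ∣ B v ∣ → Contains B (T j (6 + r)) ⊎ RedTree
        blue-vertex j k< with 3 ≤? ∣ R v ∣
        ... | yes 3≤ with blue-or-pivot j k< 3≤
        ...   | inj₁ blue  = inj₁ blue
        ...   | inj₂ pivot = inj₂ (red-from-pivot 3≤ pivot)
        -- The blue degree is at least 2k - 2, and `9 ≤ k`, that is m ≥ 12, makes this at least
        -- `7 + k`.
        blue-vertex j k< | no ≱3 = few-red-neighbours j (s≤s⁻¹ (s≤s⁻¹ (begin
          9 + k                 ≤⟨ +-monoˡ-≤ k 9≤k ⟩
          k + k                 ≤⟨ degree-sum v ⟩
          ∣ R v ∣ + ∣ B v ∣     ≤⟨ +-monoˡ-≤ ∣ B v ∣ (s≤s⁻¹ (≰⇒> ≱3)) ⟩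
          2 + ∣ B v ∣           ∎)))
          where open ≤-Reasoning

      -- All red degrees at least k

      module MinDegree (deg : ∀ u → k ≤ ∣ R u ∣) (v : Fin n) where

        Z : Sub n
        Z = ∁ (R v) ─ v

        Z⇒≢v : ∀ {z} → z ∈ Z → v ≢ z
        Z⇒≢v z∈ = ≢-sym (∈─⇒≢ (∁ (R v)) z∈)

        Z⇒≁v : ∀ {z} → z ∈ Z → z ∉ R v
        Z⇒≁v z∈ = not-true⇒ (─⊆ (∁ (R v)) v _ z∈)

        N≢Z : ∀ {a z} → a ∈ R v → z ∈ Z → a ≢ z
        N≢Z va z∈ refl = Z⇒≁v z∈ va

        classify : ∀ i → i ≢ v → i ∈ R v ⊎ i ∈ Z
        classify i i≢v with ∈⊎∉ i (R v)
        ... | inj₁ e = inj₁ e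
        ... | inj₂ e = inj₂ (∈─ (∁ (R v)) (⇒not-true e) i≢v)

        size≥ : k + k ≤ ∣ R v ∣ + ∣ Z ∣
        size≥ = s≤s⁻¹ (subst (_≤ suc (∣ R v ∣ + ∣ Z ∣)) (trans (∣⊤∣ n) n≡)
          (≤-trans (∣∣≤suc∣─∣ ⊤ v) (s≤s (cover (⊤ ─ v) (R v) Z λ i i∈ → classify i (∈─⇒≢ ⊤ i∈)))))
          where
          ⊤ : Sub n
          ⊤ _ = true

        size≤ : ∣ R v ∣ + ∣ Z ∣ ≤ k + k
        size≤ = s≤s⁻¹ (subst (suc (∣ R v ∣ + ∣ Z ∣) ≤_) (trans (∣⊤∣ n) n≡)
          (≤-trans (s≤s (pack (R v) Z (⊤ ─ v)
              (λ i vi → ∈─ ⊤ refl (≢-sym (R⇒≢ vi)))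
              (λ i i∈ → ∈─ ⊤ refl (≢-sym (Z⇒≢v i∈)))
              (λ i vi i∈ → Z⇒≁v i∈ vi)))
            (pack₁ (⊤ ─ v) ⊤ v refl (λ _ _ → refl) (∉─ ⊤ v))))
          where
          ⊤ : Sub n
          ⊤ _ = true

        degree-Z : ∀ z → z ∈ Z → k ≤ ∣ R v ∩ R z ∣ + ∣ Z ∩ R z ∣
        degree-Z z z∈ = ≤-trans (deg z) (cover (R z) (R v ∩ R z) (Z ∩ R z) h)
          where
          h : ∀ i → i ∈ R z → i ∈ (R v ∩ R z) ⊎ i ∈ (Z ∩ R z)
          h i zi with classify i (λ { refl → Z⇒≁v z∈ (R-symm zi) })
          ... | inj₁ e = inj₁ (∧-intro e zi)
          ... | inj₂ e = inj₂ (∧-intro e zi)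

        degree-N : ∀ a → k ≤ suc (∣ R v ∩ R a ∣ + ∣ Z ∩ R a ∣)
        degree-N a = ≤-trans (deg a) (≤-trans (∣∣≤suc∣─∣ (R a) v)
          (s≤s (cover (R a ─ v) (R v ∩ R a) (Z ∩ R a) h)))
          where
          h : ∀ i → i ∈ (R a ─ v) → i ∈ (R v ∩ R a) ⊎ i ∈ (Z ∩ R a)
          h i i∈ with classify i (∈─⇒≢ (R a) i∈)
          ... | inj₁ e = inj₁ (∧-intro e (─⊆ (R a) v i i∈))
          ... | inj₂ e = inj₂ (∧-intro e (─⊆ (R a) v i i∈))

        inner-N : ∀ a → ∣ Z ∩ R a ∣ ≤ 1 → 2 ≤ ∣ R v ∩ R a ∣
        inner-N a ≤1 = +-cancelʳ-≤ 1 _ _ (s≤s⁻¹ (≤-trans (≤-trans (m≤n+m 4 5) 9≤k)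
          (≤-trans (degree-N a) (s≤s (+-monoʳ-≤ ∣ R v ∩ R a ∣ ≤1)))))

        inner-Z : ∀ z → z ∈ Z → suc ∣ Z ∩ R z ∣ ≤ ∣ Z ∣
        inner-Z z z∈ = pack₁ (Z ∩ R z) Z z z∈ (λ i → ∧-elimˡ) (λ e → R⇒≢ (∧-elimʳ {Z z} e) refl)

        -- At most `∣ Z ∣` - 1 of the k or more red neighbours of `z` lie in `Z`, and all the others
        -- lie in `R v`.
        outer-Z : ∀ t → t + ∣ Z ∣ ≤ k → ∀ z → z ∈ Z → suc t ≤ ∣ R v ∩ R z ∣
        outer-Z t t+Z≤k z z∈ = +-cancelʳ-≤ ∣ Z ∣ _ _ (begin
          suc t + ∣ Z ∣                         ≤⟨ s≤s t+Z≤k ⟩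
          suc k                                 ≤⟨ s≤s (degree-Z z z∈) ⟩
          suc (∣ R v ∩ R z ∣ + ∣ Z ∩ R z ∣)     ≡⟨ +-suc ∣ R v ∩ R z ∣ ∣ Z ∩ R z ∣ ⟨
          ∣ R v ∩ R z ∣ + suc ∣ Z ∩ R z ∣       ≤⟨ +-monoʳ-≤ ∣ R v ∩ R z ∣ (inner-Z z z∈) ⟩
          ∣ R v ∩ R z ∣ + ∣ Z ∣                 ∎)
          where open ≤-Reasoning

        red-double : ∀ a₁ a₂ z₁ z₂ → a₁ ∈ R v → a₂ ∈ R v → z₁ ∈ Z → z₂ ∈ Z →
          R a₁ z₁ ≡ true → R a₂ z₂ ≡ true → a₁ ≢ a₂ → z₁ ≢ z₂ → Contains R (T¹ (5 + r))
        red-double a₁ a₂ z₁ z₂ va₁ va₂ z₁∈ z₂∈ e₁ e₂ a≢ z≢ =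
          ER.embed-tree R-irr double v a₁ a₂ z₁ z₂ (R v ─ a₁ ─ a₂) (e₁ , e₂) va₁ va₂ (Z⇒≢v z₁∈) (Z⇒≢v z₂∈)
            ((a≢ ∷ N≢Z va₁ z₁∈ ∷ N≢Z va₁ z₂∈ ∷ []) ∷ (N≢Z va₂ z₁∈ ∷ N≢Z va₂ z₂∈ ∷ []) ∷ (z≢ ∷ []) ∷ [] ∷ [])
            S⊆
            (∉─ (R v) a₁ ∘ ─⊆ (R v ─ a₁) a₂ a₁ ∷ ∉─ (R v ─ a₁) a₂
              ∷ Z⇒≁v z₁∈ ∘ S⊆ z₁ ∷ Z⇒≁v z₂∈ ∘ S⊆ z₂ ∷ [])
            (s≤s⁻¹ (s≤s⁻¹ (≤-trans (deg v) (≤-trans (∣∣≤suc∣─∣ (R v) a₁) (s≤s (∣∣≤suc∣─∣ (R v ─ a₁) a₂))))))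
          where
          S⊆ : (R v ─ a₁ ─ a₂) ⊆ R v
          S⊆ i = ─⊆ (R v) a₁ i ∘ ─⊆ (R v ─ a₁) a₂ i

        red-cherry : ∀ a → a ∈ R v → 2 ≤ ∣ Z ∩ R a ∣ → Contains R (T² (5 + r))
        red-cherry a va 2≤
          with x , x∈ ← pick (Z ∩ R a) (≤-trans (s≤s z≤n) 2≤)
          with y , y∈ , y≢x ← pick-≢ (Z ∩ R a) x 2≤ =
          ER.embed-stem R-irr cherry v a x y (R v ─ a) (λ _ → ax , ay) va (Z⇒≢v zx) (Z⇒≢v zy)
            ((R⇒≢ ax ∷ R⇒≢ ay ∷ []) ∷ (≢-sym y≢x ∷ []) ∷ [] ∷ [])
            (─⊆ (R v) a)
            (∉─ (R v) a ∷ Z⇒≁v zx ∘ ─⊆ (R v) a x ∷ Z⇒≁v zy ∘ ─⊆ (R v) a y ∷ [])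
            (s≤s⁻¹ (≤-trans (deg v) (∣∣≤suc∣─∣ (R v) a)))
          where
          zx = ∧-elimˡ {Z x} x∈
          ax = ∧-elimʳ {Z x} x∈
          zy = ∧-elimˡ {Z y} y∈
          ay = ∧-elimʳ {Z y} y∈

        red-high-degree : ∀ sh → suc k ≤ ∣ R v ∣ → Contains R (treeOf sh (5 + r))
        red-high-degree sh k< with 3 ≤? ∣ Z ∣
        ... | no ≱3 = ER.embed-dense R-irr sh v (R v) (λ _ e → e)
              (≤-trans (m≤n+m (2 + k) 5) big) dense
          where
          open ≤-Reasoning
          ∣Z∣≤2 : ∣ Z ∣ ≤ 2
          ∣Z∣≤2 = s≤s⁻¹ (≰⇒> ≱3)
          big : 7 + k ≤ ∣ R v ∣
          big = +-cancelʳ-≤ 2 _ _ (begin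
            7 + k + 2          ≡⟨ +-comm (7 + k) 2 ⟩
            9 + k              ≤⟨ +-monoˡ-≤ k 9≤k ⟩
            k + k              ≤⟨ size≥ ⟩
            ∣ R v ∣ + ∣ Z ∣    ≤⟨ +-monoʳ-≤ ∣ R v ∣ ∣Z∣≤2 ⟩
            ∣ R v ∣ + 2        ∎)
          dense : ∀ u → u ∈ R v → 3 ≤ ∣ R v ∩ R u ∣
          dense u _ = +-cancelʳ-≤ 2 _ _ (s≤s⁻¹ (begin
            6                                      ≤⟨ ≤-trans (m≤n+m 6 3) 9≤k ⟩
            k                                      ≤⟨ degree-N u ⟩
            suc (∣ R v ∩ R u ∣ + ∣ Z ∩ R u ∣)      ≤⟨ s≤s (+-monoʳ-≤ ∣ R v ∩ R u ∣
              (≤-trans (∣∣-mono (Z ∩ R u) Z (λ i → ∧-elimˡ)) ∣Z∣≤2)) ⟩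
            suc (∣ R v ∩ R u ∣ + 2)                ∎))
        -- Now `∣ R v ∣` is k + (t + 1) and `∣ Z ∣` is k - (t + 1), so every vertex of `Z` has at
        -- least t + 2 neighbours in `R v`.
        ... | yes 3≤ with t , eq ← m≤n⇒∃[o]m+o≡n k< = build sh
          where
          open ≤-Reasoning
          size : ∣ R v ∣ ≡ k + suc t
          size = trans (sym eq) (sym (+-suc k t))
          t+Z≤k : suc t + ∣ Z ∣ ≤ k
          t+Z≤k = +-cancelˡ-≤ k _ _ (begin
            k + (suc t + ∣ Z ∣)    ≡⟨ +-assoc k (suc t) ∣ Z ∣ ⟨
            k + suc t + ∣ Z ∣      ≡⟨ cong (_+ ∣ Z ∣) size ⟨
            ∣ R v ∣ + ∣ Z ∣        ≤⟨ size≤ ⟩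
            k + k                  ∎)
          k≤t+Z : k ≤ suc t + ∣ Z ∣
          k≤t+Z = +-cancelˡ-≤ k _ _ (begin
            k + k                  ≤⟨ size≥ ⟩
            ∣ R v ∣ + ∣ Z ∣        ≡⟨ cong (_+ ∣ Z ∣) size ⟩
            k + suc t + ∣ Z ∣      ≡⟨ +-assoc k (suc t) ∣ Z ∣ ⟩
            k + (suc t + ∣ Z ∣)    ∎)
          outer : ∀ z → z ∈ Z → suc (suc t) ≤ ∣ R v ∩ R z ∣
          outer = outer-Z (suc t) t+Z≤k
          outer₂ : ∀ z → z ∈ Z → 2 ≤ ∣ R v ∩ R z ∣
          outer₂ z z∈ = ≤-trans (s≤s (s≤s z≤n)) (outer z z∈)
          build : ∀ sh → Contains R (treeOf sh (5 + r))
          build double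
            with z₁ , z₁∈ ← pick Z (≤-trans (s≤s z≤n) 3≤)
            with z₂ , z₂∈ , z₂≢z₁ ← pick-≢ Z z₁ (≤-trans (s≤s (s≤s z≤n)) 3≤)
            with a₁ , a₁∈ ← pick (R v ∩ R z₁) (≤-trans (s≤s z≤n) (outer z₁ z₁∈))
            with a₂ , a₂∈ , a₂≢a₁ ← pick-≢ (R v ∩ R z₂) a₁ (outer₂ z₂ z₂∈) =
            red-double a₁ a₂ z₁ z₂ (∧-elimˡ a₁∈) (∧-elimˡ a₂∈) z₁∈ z₂∈
              (R-symm (∧-elimʳ {R v a₁} a₁∈)) (R-symm (∧-elimʳ {R v a₂} a₂∈)) (≢-sym a₂≢a₁) (≢-sym z₂≢z₁)
          build cherry with search (R v) (λ a → ∣ Z ∩ R a ∣) 2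
          ... | inj₁ (a , va , 2≤) = red-cherry a va 2≤
          ... | inj₂ sparse = ⊥-elim (double-count-bound {k} {suc t} {∣ Z ∣} (s≤s z≤n) 3≤ k≤t+Z
            (subst (suc (suc t) * ∣ Z ∣ ≤_) size
              (double-count R R-sym (R v) Z (suc (suc t)) (λ a va → s≤s⁻¹ (sparse a va)) outer)))
          -- The tail leaves `v` through `a`, visits `z` and returns to `a′` in `R v`. Since `v` has
          -- at least k + 1 neighbours, enough leaves remain without `a′`.
          build path
            with z , z∈ ← pick Z (≤-trans (s≤s z≤n) 3≤)
            with a , a∈ ← pick (R v ∩ R z) (≤-trans (s≤s z≤n) (outer z z∈))
            with a′ , a′∈ , a′≢a ← pick-≢ (R v ∩ R z) a (outer₂ z z∈) =
            ER.embed-stem R-irr path v a z a′ (R v ─ a ─ a′)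
              (λ _ → R-symm (∧-elimʳ {R v a} a∈) , ∧-elimʳ {R v a′} a′∈)
              (∧-elimˡ a∈) (Z⇒≢v z∈) (R⇒≢ (∧-elimˡ a′∈))
              ((N≢Z (∧-elimˡ a∈) z∈ ∷ ≢-sym a′≢a ∷ []) ∷ (≢-sym (N≢Z (∧-elimˡ a′∈) z∈) ∷ []) ∷ [] ∷ [])
              (λ i → ─⊆ (R v) a i ∘ ─⊆ (R v ─ a) a′ i)
              (∉─ (R v) a ∘ ─⊆ (R v ─ a) a′ a ∷ Z⇒≁v z∈ ∘ ─⊆ (R v) a z ∘ ─⊆ (R v ─ a) a′ z
                ∷ ∉─ (R v ─ a) a′ ∷ [])
              (s≤s⁻¹ (s≤s⁻¹ (≤-trans k< (≤-trans (∣∣≤suc∣─∣ (R v) a) (s≤s (∣∣≤suc∣─∣ (R v ─ a) a′))))))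

        -- All red degrees equal to k

        module Regular (deg≤ : ∀ u → ∣ R u ∣ ≤ k) where

          k≤∣Z∣ : k ≤ ∣ Z ∣
          k≤∣Z∣ = +-cancelˡ-≤ k _ _ (≤-trans size≥ (+-monoˡ-≤ ∣ Z ∣ (deg≤ v)))

          ∣Z∣≤k : ∣ Z ∣ ≤ k
          ∣Z∣≤k = +-cancelˡ-≤ k _ _ (≤-trans (+-monoˡ-≤ ∣ Z ∣ (deg v)) size≤)

          outer : ∀ z → z ∈ Z → 1 ≤ ∣ R v ∩ R z ∣
          outer = outer-Z 0 ∣Z∣≤k

          -- Otherwise `a` would be adjacent to `v` and to all k vertices of `Z`, exceeding degree
          -- k.
          missed : ∀ a → a ∈ R v → ∃ λ z → z ∈ Z × z ∉ R a
          -- The second vertex of this search is a dummy; only `z` matters.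
          missed a va with search₂ Z (λ z i → not (R a z))
          ... | inj₁ (z , _ , z∈ , e) = z , z∈ , not-true⇒ e
          ... | inj₂ none = ⊥-elim (<⇒≱ (≤-trans (s≤s k≤∣Z∣)
                  (pack₁ Z (R a) v (R-symm va) Z⊆ (λ e → Z⇒≢v e refl))) (deg≤ a))
            where
            Z⊆ : Z ⊆ R a
            Z⊆ z z∈ with ∈⊎∉ z (R a)
            ... | inj₁ e = e
            ... | inj₂ e = ⊥-elim (none z z z∈ (⇒not-true e))

          red-regular : ∀ sh → Contains R (treeOf sh (5 + r))
          -- As `a₁` is adjacent to `z₁` but not to `z₂`, the choice of `z₂` makes both the two
          -- edges' ends in `Z` and their ends in `R v` distinct.
          red-regular double
            with z₁ , z₁∈ ← pick Z (≤-trans (s≤s z≤n) k≤∣Z∣)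
            with a₁ , a₁∈ ← pick (R v ∩ R z₁) (outer z₁ z₁∈)
            with z₂ , z₂∈ , a₁≁z₂ ← missed a₁ (∧-elimˡ a₁∈)
            with a₂ , a₂∈ ← pick (R v ∩ R z₂) (outer z₂ z₂∈) =
            red-double a₁ a₂ z₁ z₂ (∧-elimˡ a₁∈) (∧-elimˡ a₂∈) z₁∈ z₂∈ a₁~z₁ a₂~z₂
              (λ { refl → a₁≁z₂ a₂~z₂ }) (λ { refl → a₁≁z₂ a₁~z₁ })
            where
            a₁~z₁ = R-symm (∧-elimʳ {R v a₁} a₁∈)
            a₂~z₂ = R-symm (∧-elimʳ {R v a₂} a₂∈)
          red-regular cherry with search (R v) (λ a → ∣ Z ∩ R a ∣) 2
          ... | inj₁ (a , va , 2≤) = red-cherry a va 2≤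
          -- Truncated subtraction turns the search for fewer than 2 neighbours into a search for a
          -- value of at least 1.
          ... | inj₂ sparse with search Z (λ z → 2 ∸ ∣ R v ∩ R z ∣) 1
          -- Two neighbours in `R v` for every vertex of `Z` would give 2k ≤ k by double counting.
          ...   | inj₂ none = ⊥-elim (<⇒≱ (≤-trans (m<m+n k (s≤s z≤n))
                    (≤-trans (≤-reflexive (cong (k +_) (sym (+-identityʳ k))))
                      (≤-trans (*-monoʳ-≤ 2 k≤∣Z∣)
                        (double-count R R-sym (R v) Z 2 (λ a va → s≤s⁻¹ (sparse a va))
                          λ z z∈ → m∸n≡0⇒m≤n (n≤0⇒n≡0 (s≤s⁻¹ (none z z∈)))))))
                    (deg≤ v))
          -- Here `a` is the only neighbour of `z` in `R v`, so the neighbours `x` and `y` of `a` in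
          -- `R v` are not adjacent to `z`. The tree is centred at `z` and branches at `a`.
          ...   | inj₁ (z , z∈ , 1≤)
            with a , a∈ ← pick (R v ∩ R z) (outer z z∈)
            with x , x∈ ← pick (R v ∩ R a) (≤-trans (s≤s z≤n) (inner-N a (s≤s⁻¹ (sparse a (∧-elimˡ a∈)))))
            with y , y∈ , y≢x ← pick-≢ (R v ∩ R a) x (inner-N a (s≤s⁻¹ (sparse a (∧-elimˡ a∈)))) =
            ER.embed-stem R-irr cherry z a x y (R z ─ a) (λ _ → ax , ay) (∧-elimʳ {R v a} a∈)
              (≢-sym (N≢Z vx z∈)) (≢-sym (N≢Z vy z∈))
              ((R⇒≢ ax ∷ R⇒≢ ay ∷ []) ∷ (≢-sym y≢x ∷ []) ∷ [] ∷ [])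
              (─⊆ (R z) a)
              (∉─ (R z) a ∷ z≁ vx ax ∘ ─⊆ (R z) a x ∷ z≁ vy ay ∘ ─⊆ (R z) a y ∷ [])
              (s≤s⁻¹ (≤-trans (deg z) (∣∣≤suc∣─∣ (R z) a)))
            where
            vx = ∧-elimˡ {R v x} x∈
            ax = ∧-elimʳ {R v x} x∈
            vy = ∧-elimˡ {R v y} y∈
            ay = ∧-elimʳ {R v y} y∈
            only-a : ∣ R v ∩ R z ∣ ≤ 1
            only-a = s≤s⁻¹ (m∸n≢0⇒n<m λ e → <⇒≢ 1≤ (sym e))
            z≁ : ∀ {w} → w ∈ R v → R a w ≡ true → w ∉ R z
            z≁ vw aw zw = R⇒≢ aw (∣∣≤1⇒≡ (R v ∩ R z) only-a a∈ (∧-intro vw zw))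
          red-regular path
            with a , va ← pick (R v) (≤-trans (s≤s z≤n) (deg v))
            with z , z∈ , a≁z ← missed a va
            -- Since `z` misses `a`, at most k - 1 of its k neighbours lie in `R v`, and another
            -- lies in `Z`.
            with z′ , z′∈ ← pick (Z ∩ R z) (+-cancelˡ-≤ ∣ R v ∩ R z ∣ _ _
              (≤-trans (≤-reflexive (+-comm ∣ R v ∩ R z ∣ 1))
                (≤-trans (≤-trans (pack₁ (R v ∩ R z) (R v) a va (λ i → ∧-elimˡ)
                  (λ e → a≁z (R-symm (∧-elimʳ {R v a} e)))) (deg≤ v)) (degree-Z z z∈))))
            with b , b∈ ← pick (R v ∩ R z) (outer z z∈) =
            ER.embed-stem R-irr path v b z z′ (R v ─ b) (λ _ → R-symm zb , zz′) vb (Z⇒≢v z∈) (Z⇒≢v z′∈Z)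
              ((N≢Z vb z∈ ∷ N≢Z vb z′∈Z ∷ []) ∷ (R⇒≢ zz′ ∷ []) ∷ [] ∷ [])
              (─⊆ (R v) b)
              (∉─ (R v) b ∷ Z⇒≁v z∈ ∘ ─⊆ (R v) b z ∷ Z⇒≁v z′∈Z ∘ ─⊆ (R v) b z′ ∷ [])
              (s≤s⁻¹ (≤-trans (deg v) (∣∣≤suc∣─∣ (R v) b)))
            where
            vb = ∧-elimˡ {R v b} b∈
            zb = ∧-elimʳ {R v b} b∈
            z′∈Z = ∧-elimˡ {Z z′} z′∈
            zz′ = ∧-elimʳ {Z z′} z′∈

      colouring-tree : Fin n → ∀ j → Contains B (T j (6 + r)) ⊎ RedTree
      colouring-tree v₀ j with search (λ _ → true) (λ v → ∣ B v ∣) (suc k)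
      ... | inj₁ (v , _ , k<) = blue-vertex v j k<
      ... | inj₂ blue≤ with search (λ _ → true) (λ v → ∣ R v ∣) (suc k)
      ...   | inj₁ (v , _ , k<) = inj₂ (MinDegree.red-high-degree deg v sh k<)
        where
        deg : ∀ u → k ≤ ∣ R u ∣
        deg u = +-cancelʳ-≤ k _ _ (≤-trans (degree-sum u) (+-monoʳ-≤ ∣ R u ∣ (s≤s⁻¹ (blue≤ u refl))))
      -- All red degrees are now k, so any vertex can serve as `v`.
      ...   | inj₂ red≤ = inj₂ (MinDegree.Regular.red-regular deg v₀ (λ u → s≤s⁻¹ (red≤ u refl)) sh)
        where
        deg : ∀ u → k ≤ ∣ R u ∣
        deg u = +-cancelʳ-≤ k _ _ (≤-trans (degree-sum u) (+-monoʳ-≤ ∣ R u ∣ (s≤s⁻¹ (blue≤ u refl))))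

-- The lower bound

complement⇒¬ : ∀ {n} (G : Graph n) {u v} → complement G u v ≡ true → ¬ (G u v ≡ true)
complement⇒¬ G e = not-true⇒ (∧-elimˡ e)

complement⇒≢ : ∀ {n} (G : Graph n) {u v} → complement G u v ≡ true → u ≢ v
complement⇒≢ G {u} {v} e u≡v = not-true⇒ (∧-elimʳ {not (G u v)} e) (≡⇒∈⁅⁆ u v u≡v)

complement-intro : ∀ {n} (G : Graph n) {u v} → ¬ (G u v ≡ true) → u ≢ v → complement G u v ≡ true
complement-intro G {u} {v} ¬Guv u≢v = ∧-intro (⇒not-true ¬Guv) (⇒not-true (u≢v ∘ ∈⁅⁆⇒≡ u v))

⌊≟⌋-sym : ∀ {n} (a b : Fin n) → ⌊ a ≟F b ⌋ ≡ ⌊ b ≟F a ⌋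
⌊≟⌋-sym a b with a ≟F b | b ≟F a
... | yes _ | yes _ = refl
... | no  _ | no  _ = refl
... | yes e | no ne = ⊥-elim (ne (sym e))
... | no ne | yes e = ⊥-elim (ne (sym e))

complement-simple : ∀ {n} (G : Graph n) → IsSimple G → IsSimple (complement G)
complement-simple G (G-sym , _) =
  (λ u v → cong₂ (λ a b → not a ∧ not b) (G-sym u v) (⌊≟⌋-sym u v)) , irr
  where
  irr : ∀ u → complement G u u ≡ false
  irr u with complement G u u in e
  ... | true  = ⊥-elim (complement⇒≢ G e refl)
  ... | false = refl

edge-or-complement : ∀ {n} (G : Graph n) {u v} → u ≢ v → G u v ≡ true ⊎ complement G u v ≡ true
edge-or-complement G {u} {v} u≢v = map₂ (λ ¬Guv → complement-intro G ¬Guv u≢v) (∈⊎∉ v (G u))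

upper-bound : ∀ sh j r → 7 ≤ r → RamseyProp (treeOf sh (5 + r)) (T j (6 + r)) (suc ((2 + r) + (2 + r)))
upper-bound sh j r 7≤r G simple
  with G̅-sym , G̅-irr ← complement-simple G simple
  with colour ← Upper.Colouring.colouring-tree r 7≤r refl G (complement G) (proj₁ simple) (proj₂ simple)
    G̅-sym G̅-irr (complement⇒¬ G) (edge-or-complement G) sh zero j
  with colour
... | inj₁ blue = inj₂ blue
... | inj₂ red  = inj₁ red

-- The lower bound sees a tree only through the star at vertex 0, which is common to all three
-- shapes.
star-edge : ∀ sh r (i : Fin (2 + r)) →
  treeOf sh (5 + r) zero (suc (inject≤ i (m≤n+m (2 + r) 2))) ≡ true
star-edge sh r i = go sh
  where
  i< : (suc (toℕ (inject≤ i (m≤n+m (2 + r) 2))) ≤ᵇ 2 + r) ≡ true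
  i< = Equivalence.to T-≡ (≤⇒≤ᵇ (subst (_< 2 + r) (sym (toℕ-inject≤ i _)) (toℕ<n i)))
  go : ∀ sh → treeOf sh (5 + r) zero (suc (inject≤ i (m≤n+m (2 + r) 2))) ≡ true
  go double rewrite i< = refl
  go cherry rewrite i< = refl
  go path   rewrite i< = refl

-- φ w bounds the degree of w by 1 + r, since it embeds w and its neighbours in 2 + r points.
tree-free : ∀ {n} (G : Graph n) sh r (φ : Fin n → Fin n → Fin (2 + r)) →
  (∀ w u v → u ≡ w ⊎ G w u ≡ true → v ≡ w ⊎ G w v ≡ true → φ w u ≡ φ w v → u ≡ v) →
  ¬ Contains G (treeOf sh (5 + r))
tree-free G sh r φ φ-inj (f , f-inj , f-edge) = 1+n≰n (injective⇒≤ {f = φ w ∘ f ∘ ι} inj)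
  where
  w = f zero
  ι : Fin (3 + r) → Fin (5 + r)
  ι i = inject≤ i (m≤n+m (3 + r) 2)
  near : ∀ i → f (ι i) ≡ w ⊎ G w (f (ι i)) ≡ true
  near zero    = inj₁ refl
  near (suc i) = inj₂ (f-edge zero (ι (suc i)) (star-edge sh r i))
  inj : Injective _≡_ _≡_ (φ w ∘ f ∘ ι)
  inj {i} {j} e = inject≤-injective _ _ i j (f-inj (φ-inj w _ _ (near i) (near j) e))

module Lower (k M : ℕ) (M≤ : M ≤ 2 * k) where

  -- Splitting `Fin (2 * k)` by `remQuot` gives the part of K_{k,k} and the position in it, matched
  -- vertices having equal position. The injection handles every `M` up to 2k at once.
  side : Fin M → Fin 2
  side u = proj₁ (remQuot {2} k (inject≤ u M≤))

  pos : Fin M → Fin k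
  pos u = proj₂ (remQuot {2} k (inject≤ u M≤))

  side-pos-injective : ∀ {u v} → side u ≡ side v → pos u ≡ pos v → u ≡ v
  side-pos-injective {u} {v} s p = inject≤-injective M≤ M≤ u v
    (trans (sym (combine-remQuot {2} k (inject≤ u M≤)))
      (trans (cong₂ combine s p) (combine-remQuot {2} k (inject≤ v M≤))))

  opposite-sides : ∀ {a b c : Fin 2} → c ≢ a → c ≢ b → a ≡ b
  opposite-sides {zero}     {zero}     _ _ = refl
  opposite-sides {suc zero} {suc zero} _ _ = refl
  opposite-sides {zero}     {suc zero} {zero}     x _ = ⊥-elim (x refl)
  opposite-sides {zero}     {suc zero} {suc zero} _ y = ⊥-elim (y refl)
  opposite-sides {suc zero} {zero}     {zero}     _ y = ⊥-elim (y refl)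
  opposite-sides {suc zero} {zero}     {suc zero} x _ = ⊥-elim (x refl)

  -- An induced subgraph of K_{k,k} minus a perfect matching.
  R : Graph M
  R u v = not ⌊ side u ≟F side v ⌋ ∧ not ⌊ pos u ≟F pos v ⌋

  R⇒side≢ : ∀ u v → R u v ≡ true → side u ≢ side v
  R⇒side≢ u v e s = not-true⇒ (∧-elimˡ e) (≡⇒∈⁅⁆ (side u) (side v) s)

  R⇒pos≢ : ∀ u v → R u v ≡ true → pos u ≢ pos v
  R⇒pos≢ u v e p =
    not-true⇒ (∧-elimʳ {not ⌊ side u ≟F side v ⌋} e) (≡⇒∈⁅⁆ (pos u) (pos v) p)

  R-intro : ∀ u v → side u ≢ side v → pos u ≢ pos v → R u v ≡ true
  R-intro u v s p = ∧-intro (⇒not-true (s ∘ ∈⁅⁆⇒≡ (side u) (side v))) (⇒not-true (p ∘ ∈⁅⁆⇒≡ (pos u) (pos v)))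

  R-simple : IsSimple R
  R-simple =
    (λ u v → cong₂ (λ a b → not a ∧ not b) (⌊≟⌋-sym (side u) (side v)) (⌊≟⌋-sym (pos u) (pos v))) , irr
    where
    irr : ∀ u → R u u ≡ false
    irr u with R u u in e
    ... | true  = ⊥-elim (R⇒side≢ u u e refl)
    ... | false = refl

  -- Neighbours of `w` share the opposite side, where `pos` separates them; removing the matching
  -- leaves the position of `w` free for `w` itself.
  red-near-injective : ∀ w u v → u ≡ w ⊎ R w u ≡ true → v ≡ w ⊎ R w v ≡ true → pos u ≡ pos v → u ≡ v
  red-near-injective w u v (inj₁ refl) (inj₁ refl) _ = refl
  red-near-injective w u v (inj₁ refl) (inj₂ e)    p = ⊥-elim (R⇒pos≢ w v e p)
  red-near-injective w u v (inj₂ e)    (inj₁ refl) p = ⊥-elim (R⇒pos≢ w u e (sym p))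
  red-near-injective w u v (inj₂ e)    (inj₂ e′)   p =
    side-pos-injective (opposite-sides (R⇒side≢ w u e) (R⇒side≢ w v e′)) p

  -- The only blue neighbour of w on the other side is its partner, sent to the extra point.
  ψ : Fin M → Fin M → Fin (suc k)
  ψ w u with side w ≟F side u
  ... | yes _ = inject₁ (pos u)
  ... | no  _ = fromℕ k

  ψ-same : ∀ w u → side w ≡ side u → ψ w u ≡ inject₁ (pos u)
  ψ-same w u s with side w ≟F side u
  ... | yes _ = refl
  ... | no s′ = ⊥-elim (s′ s)

  ψ-opposite : ∀ w u → side w ≢ side u → ψ w u ≡ fromℕ k
  ψ-opposite w u s with side w ≟F side u
  ... | yes s′ = ⊥-elim (s s′)
  ... | no _   = refl

  partner : ∀ w u → u ≡ w ⊎ complement R w u ≡ true → side w ≢ side u → pos w ≡ pos u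
  partner w u (inj₁ refl) s = ⊥-elim (s refl)
  partner w u (inj₂ e)    s with ≡⊎≢ (pos w) (pos u)
  ... | inj₁ p = p
  ... | inj₂ p = ⊥-elim (complement⇒¬ R e (R-intro w u s p))

  blue-near-injective : ∀ w u v → u ≡ w ⊎ complement R w u ≡ true → v ≡ w ⊎ complement R w v ≡ true →
    ψ w u ≡ ψ w v → u ≡ v
  blue-near-injective w u v nu nv e with ≡⊎≢ (side w) (side u) | ≡⊎≢ (side w) (side v)
  ... | inj₁ s | inj₁ s′ = side-pos-injective (trans (sym s) s′)
    (inject₁-injective (trans (sym (ψ-same w u s)) (trans e (ψ-same w v s′))))
  ... | inj₁ s | inj₂ s′ =
    ⊥-elim (fromℕ≢inject₁ (trans (sym (ψ-opposite w v s′)) (trans (sym e) (ψ-same w u s))))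
  ... | inj₂ s | inj₁ s′ =
    ⊥-elim (fromℕ≢inject₁ (trans (sym (ψ-opposite w u s)) (trans e (ψ-same w v s′))))
  ... | inj₂ s | inj₂ s′ =
    side-pos-injective (opposite-sides s s′) (trans (sym (partner w u nu s)) (partner w v nv s′))

T≡treeOf : ∀ j s → T j s ≡ treeOf (shapeOf j) s
T≡treeOf one s = refl
T≡treeOf two s = refl

lower-bound : ∀ sh j r M → M < suc ((2 + r) + (2 + r)) → ¬ RamseyProp (treeOf sh (5 + r)) (T j (6 + r)) M
lower-bound sh j r M M< ramsey = contradict (ramsey R R-simple)
  where
  open Lower (2 + r) M (subst (M ≤_) (cong ((2 + r) +_) (sym (+-identityʳ (2 + r)))) (s≤s⁻¹ M<))
  contradict : Contains R (treeOf sh (5 + r)) ⊎ Contains (complement R) (T j (6 + r)) → ⊥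
  contradict (inj₁ red)  = tree-free R sh r (λ _ → pos) red-near-injective red
  -- The blue tree has k + 1 neighbours of its centre, so it is compared with the `suc k` values of
  -- `ψ`.
  contradict (inj₂ blue) = tree-free (complement R) (shapeOf j) (suc r) ψ blue-near-injective
    (subst (Contains (complement R)) (T≡treeOf j (6 + r)) blue)

ramsey-number : ∀ sh j r → 7 ≤ r →
  IsRamseyNumber (treeOf sh (5 + r)) (T j (6 + r)) (suc ((2 + r) + (2 + r)))
ramsey-number sh j r 7≤r = s≤s z≤n , upper-bound sh j r 7≤r , λ M _ → lower-bound sh j r M

theorem6p5 : ∀ (m : ℕ) → 12 ≤ m → ∀ (i j : Idx) →
    IsRamseyNumber (T i m) (T j (m + 1)) (2 * m ∸ 5)
    × IsRamseyNumber (T* m) (T j (m + 1)) (2 * m ∸ 5)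
theorem6p5 m 12≤m i j with o , refl ← m≤n⇒∃[o]m+o≡n 12≤m =
    subst (λ G → IsRamseyNumber G _ _) (sym (T≡treeOf i m)) (number (shapeOf i))
  , number path
  where
  r = 7 + o
  -- The right-hand side is what `2 * m ∸ 5` computes to for m = 12 + o.
  count : ∀ o → suc ((9 + o) + (9 + o)) ≡ 7 + (o + (12 + o + 0))
  count = solve-∀
  number : ∀ sh → IsRamseyNumber (treeOf sh (5 + r)) (T j (5 + r + 1)) (2 * (5 + r) ∸ 5)
  number sh = subst₂ (λ s N → IsRamseyNumber (treeOf sh (5 + r)) (T j s) N)
    (+-comm 1 (5 + r)) (count o) (ramsey-number sh j r (m≤m+n 7 o))
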